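{- Let $m,n$ be positive integers and let $H_{2m,n}$ be the number of $2m\times n$ circled letter arrays fixed by the horizontal reflection $h$. Then $H_{2m,n}=(mn)!\,[z^{mn}]\exp\!\left(2(e^z-1)+\tfrac{(e^z-1)^2}{2}+ze^{2z}\right)$, i.e. $H_{2m,n}$ is the coefficient of $z^{mn}/(mn)!$ in the expansion of $\exp\!\left(2(e^z-1)+\frac{(e^z-1)^2}{2}+ze^{2z}\right)$.
   Context: Let $G_{a,b}=\{1,\dots,a\}\times\{1,\dots,b\}$ be the cells of an $a\times b$ grid. An $a\times b$ circled letter array is a pair $(\pi,C)$ where $\pi$ is a set partition of $G_{a,b}$ (blocks = letters, labels irrelevant) and $C\subseteq G_{a,b}$ is a set of circled cells such that each block of $\pi$ contains at most one cell of $C$. The horizontal reflection of the $a\times b$ grid is $h(i,j)=(a+1-i,j)$; it acts on arrays by $h\cdot(\pi,C)=(\{h(B):B\in\pi\},h(C))$, and an array is fixed by $h$ if $h\cdot(\pi,C)=(\pi,C)$. $[z^k]F$ denotes the coefficient of $z^k$ in the power series $F$. -}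

module Defs where

open import Data.Nat using (ℕ; zero; suc; _+_; _*_; _∸_; _!)
open import Data.Nat.Properties using (_!≢0)
open import Data.Bool using (Bool; true; false)
open import Data.Bool.Properties renaming (_≟_ to _≟B_)
open import Data.Fin using (Fin; combine; opposite)
open import Data.Fin.Properties using (all?) renaming (_≟_ to _≟F_)
open import Data.Product using (_×_; _,_; proj₁; proj₂)
open import Data.Product.Properties using (≡-dec)
open import Data.Vec using (Vec; []; _∷_; lookup)
open import Data.List using (List; []; _∷_; map; cartesianProduct; filter; length; concatMap; upTo)
open import Data.Integer using (+_)
open import Data.Rational using (ℚ; 0ℚ; 1ℚ; _/_) renaming (_+_ to _+q_; _*_ to _*q_)
open import Relation.Nullary using (Dec; yes; no)
open import Relation.Nullary.Decidable using (_×-dec_; _→-dec_)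
open import Relation.Binary.PropositionalEquality using (_≡_)

-- The grid G_{a,b}, cells (i , j) with i : Fin a (row), j : Fin b (column).
-- (0-indexed: Fin a = {0,…,a-1} corresponds to {1,…,a}.)

Cell : ℕ → ℕ → Set
Cell a b = Fin a × Fin b

idx : ∀ {a b} → Cell a b → Fin (a * b)
idx (i , j) = combine i j

-- horizontal reflection h(i,j) = (a+1-i, j); in 0-indexing i ↦ a-1-i = opposite i
h : ∀ {a b} → Cell a b → Cell a b
h (i , j) = (opposite i , j)

-- A set partition π of G_{a,b} is represented by its "same block" relation,
-- stored as a Boolean (a*b)×(a*b) table; it is a partition iff this
-- relation is an equivalence relation (blocks = equivalence classes).
-- A set C ⊆ G_{a,b} is stored as its characteristic vector.

BRel : ℕ → ℕ → Set
BRel a b = Vec (Vec Bool (a * b)) (a * b)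

CSet : ℕ → ℕ → Set
CSet a b = Vec Bool (a * b)

sameBlock : ∀ {a b} → BRel a b → Cell a b → Cell a b → Bool
sameBlock π x y = lookup (lookup π (idx x)) (idx y)

circled : ∀ {a b} → CSet a b → Cell a b → Bool
circled C x = lookup C (idx x)

IsSetPartition : ∀ {a b} → BRel a b → Set
IsSetPartition {a} {b} π =
  (∀ (x : Cell a b) → sameBlock π x x ≡ true) ×
  (∀ (x y : Cell a b) → sameBlock π x y ≡ true → sameBlock π y x ≡ true) ×
  (∀ (x y z : Cell a b) → sameBlock π x y ≡ true → sameBlock π y z ≡ true →
     sameBlock π x z ≡ true)

AtMostOneCircledPerBlock : ∀ {a b} → BRel a b → CSet a b → Set
AtMostOneCircledPerBlock {a} {b} π C =
  ∀ (x y : Cell a b) → sameBlock π x y ≡ true →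
    circled C x ≡ true → circled C y ≡ true → x ≡ y

IsCircledLetterArray : ∀ {a b} → BRel a b → CSet a b → Set
IsCircledLetterArray {a} {b} π C = IsSetPartition {a} {b} π × AtMostOneCircledPerBlock {a} {b} π C

-- h · (π , C) = (π , C):  {h(B) : B ∈ π} = π  and  h(C) = C.
-- Since h is an involution, {h(B)} = π iff (x ~ y ⇔ h x ~ h y) for all x, y,
-- and h(C) = C iff (x ∈ C ⇔ h x ∈ C).
FixedByH : ∀ {a b} → BRel a b → CSet a b → Set
FixedByH {a} {b} π C =
  (∀ (x y : Cell a b) → sameBlock π (h x) (h y) ≡ sameBlock π x y) ×
  (∀ (x : Cell a b) → circled C (h x) ≡ circled C x)

IsFixedArray : ∀ {a b} → BRel a b × CSet a b → Set
IsFixedArray {a} {b} (π , C) = IsCircledLetterArray {a} {b} π C × FixedByH {a} {b} π C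

∀Cell? : ∀ {a b} {P : Cell a b → Set} → (∀ x → Dec (P x)) → Dec (∀ x → P x)
∀Cell? {P = P} P? with all? (λ i → all? (λ j → P? (i , j)))
... | yes p = yes (λ { (i , j) → p i j })
... | no ¬p = no (λ q → ¬p (λ i j → q (i , j)))

_≟C_ : ∀ {a b} (x y : Cell a b) → Dec (x ≡ y)
_≟C_ = ≡-dec _≟F_ _≟F_

isFixedArray? : ∀ a b (p : BRel a b × CSet a b) → Dec (IsFixedArray {a} {b} p)
isFixedArray? a b (π , C) =
  ((∀C (λ x → sameBlock π x x ≟B true) ×-dec
    (∀C λ x → ∀C λ y →
       (sameBlock π x y ≟B true) →-dec (sameBlock π y x ≟B true)) ×-dec
    (∀C λ x → ∀C λ y → ∀C λ z →
       (sameBlock π x y ≟B true) →-dec ((sameBlock π y z ≟B true) →-dec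
         (sameBlock π x z ≟B true))))
   ×-dec
   (∀C λ x → ∀C λ y →
      (sameBlock π x y ≟B true) →-dec ((circled C x ≟B true) →-dec
        ((circled C y ≟B true) →-dec (x ≟C y)))))
  ×-dec
  ((∀C λ x → ∀C λ y → sameBlock π (h x) (h y) ≟B sameBlock π x y) ×-dec
   (∀C λ x → circled C (h x) ≟B circled C x))
  where
  ∀C : {P : Cell a b → Set} → (∀ x → Dec (P x)) → Dec (∀ x → P x)
  ∀C = ∀Cell?

allVecs : ∀ {A : Set} → List A → (k : ℕ) → List (Vec A k)
allVecs xs zero    = [] ∷ []
allVecs xs (suc k) = concatMap (λ x → map (x ∷_) (allVecs xs k)) xs

allBools : List Bool
allBools = false ∷ true ∷ []

allCandidates : ∀ a b → List (BRel a b × CSet a b)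
allCandidates a b =
  cartesianProduct (allVecs (allVecs allBools (a * b)) (a * b)) (allVecs allBools (a * b))

-- H_{a,b}: the number of a×b circled letter arrays fixed by h
-- (each candidate (π , C) occurs exactly once in allCandidates)
H : ℕ → ℕ → ℕ
H a b = length (filter (isFixedArray? a b) (allCandidates a b))

Series : Set
Series = ℕ → ℚ

Σ≤ : ℕ → (ℕ → ℚ) → ℚ
Σ≤ zero    f = f 0
Σ≤ (suc k) f = Σ≤ k f +q f (suc k)

_⊕_ : Series → Series → Series
(f ⊕ g) k = f k +q g k

_·_ : ℚ → Series → Series
(c · f) k = c *q f k

_⊛_ : Series → Series → Series
(f ⊛ g) k = Σ≤ k (λ i → f i *q g (k ∸ i))

zS : Series
zS zero          = 0ℚ
zS (suc zero)    = 1ℚ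
zS (suc (suc _)) = 0ℚ

_^S_ : Series → ℕ → Series
f ^S zero    = λ { zero → 1ℚ ; (suc _) → 0ℚ }
f ^S suc j   = f ⊛ (f ^S j)

expLin : ℕ → Series
expLin c k = (+ (c Data.Nat.^ k) / (k !)) {{k !≢0}}

expm1 : Series
expm1 zero    = 0ℚ
expm1 (suc k) = expLin 1 (suc k)

-- exp(f) for a series f with zero constant term:
--   [z^k] exp(f) = Σ_{j ≥ 0} [z^k] f^j / j!  =  Σ_{j=0}^{k} [z^k] f^j / j!
-- (the terms with j > k vanish since f^j has order ≥ j).
expS : Series → Series
expS f k = Σ≤ k (λ j → (f ^S j) k *q (+ 1 / (j !)) {{j !≢0}})

F : Series
F = ((+ 2 / 1) · expm1) ⊕ (((+ 1 / 2) · (expm1 ⊛ expm1)) ⊕ (zS ⊛ expLin 2))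

EGF : Series
EGF = expS F

{-# OPTIONS --safe #-}
module Submission where

-- The reflection acts freely on the 2m × n grid, with N = mn two-element orbits. In a fixed
-- array a block is either invariant, and then uncircled (a circle would come with its mirror
-- image), or disjoint from its mirror image. Of the blocks that meet a given set of k orbits,
-- there is 1 of the first kind and, up to mirroring, there are 2^(k-1) of the second, each with
-- k + 1 ways to circle. Removing the blocks that meet the first orbit gives a recursion for the
-- number of fixed arrays, which for the generating function E reads
-- E′ = (e^z + 2 e^{2z} + 2z e^{2z}) E. The bracket is F′, so exp F satisfies the same equation.

open import Defs
open import Data.Bool using (Bool; true; false; not; _xor_; if_then_else_)
open import Data.Bool.Properties using (xor-same; xor-assoc; xor-comm; xor-identityʳ; xor-annihilates-not; ¬-not)
open import Data.Fin using (Fin; zero; suc; toℕ; fromℕ<; inject≤; opposite; combine; remQuot)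
open import Data.Fin.Properties using (_≟_; suc-injective; toℕ-injective; toℕ-fromℕ<; toℕ-inject≤; toℕ<n; opposite-prop; opposite-involutive; remQuot-combine; combine-remQuot; +↔⊎; *↔×; 1↔⊤; 2↔Bool)
open import Data.Integer using (+_)
open import Data.List using (List; []; _∷_; map; concatMap; cartesianProductWith; filter; length; tabulate; _++_)
open import Data.List.Membership.Propositional using (_∈_)
open import Data.List.Membership.Propositional.Properties using (∈-cartesianProductWith⁺; ∈-cartesianProduct⁺; ∈-filter⁺; ∈-filter⁻; ∈-tabulate⁺; ∈-tabulate⁻)
open import Data.List.Membership.Propositional.Properties.WithK using (unique∧set⇒bag)
open import Data.List.Properties using (length-tabulate)
open import Data.List.Relation.Binary.BagAndSetEquality using (∼bag⇒↭)
open import Data.List.Relation.Binary.Permutation.Propositional.Properties using (↭-length)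
open import Data.List.Relation.Unary.All using ([]; _∷_)
open import Data.List.Relation.Unary.AllPairs using ([]; _∷_)
open import Data.List.Relation.Unary.Any using (here; there)
open import Data.List.Relation.Unary.Unique.Propositional using (Unique)
open import Data.List.Relation.Unary.Unique.Propositional.Properties using (cartesianProductWith⁺; cartesianProduct⁺; filter⁺; tabulate⁺)
open import Data.Maybe using (Maybe; just; nothing)
open import Data.Nat as ℕ using (ℕ; zero; suc; z≤n; s≤s; _!)
import Data.Nat.Properties as ℕ
open import Data.Product using (Σ; ∃; _×_; _,_; proj₁; proj₂; uncurry)
open import Data.Product.Function.NonDependent.Propositional using (_×-↔_)
open import Data.Rational using (ℚ; _/_)
open import Data.Sum using (_⊎_; inj₁; inj₂; [_,_]; isInj₁; map₂)
open import Data.Sum.Function.Propositional using (_⊎-↔_)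
open import Data.Unit using (⊤; tt)
open import Data.Vec as Vec using (Vec; []; _∷_; lookup)
open import Data.Vec.Properties using (∷-injective; lookup∘tabulate; tabulate∘lookup; tabulate-cong)
open import Function using (_∘_; const; id; _↔_; mk↔ₛ′; mk⇔; Inverse)
open import Function.Properties.Inverse using (↔-sym; ↔-trans)
open import Relation.Nullary using (¬_; yes; no; contradiction)
open import Relation.Nullary.Decidable using (⌊_⌋)
open import Relation.Unary using (Decidable)
open import Relation.Binary.PropositionalEquality hiding ([_])

-- The terms of E′/E record where the circle is. Each orbit after the first avoids the block or
-- joins it: in one way if the block is invariant, with a choice of side otherwise. This gives e^z
-- and e^{2z}. A mirror pair is uncircled or circled on the first orbit, hence two copies of e^{2z};
-- a circle on a later orbit marks that orbit, which also has two sides, hence 2z e^{2z}. The number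
-- `H` is the length of a filtered list of tables, which has no recursive structure. The tables are
-- therefore matched with an inductive family of codes without arbitrary choices: the block removed
-- is always that of the first remaining orbit, sides are measured from one fixed cell, and the
-- leftover orbits are renumbered in order. Every array then has exactly one code. As the number of
-- leftover orbits varies, the counting functions take the count of the rest as an argument;
-- shifting this argument amounts to differentiating its generating function.

module PowerSeries where
  open import Data.Nat using (_∸_)
  open import Data.Integer as ℤ using ()
  import Data.Integer.Properties as ℤ
  open import Data.Rational using (0ℚ; 1ℚ; _+_; _*_; toℚᵘ)
  import Data.Rational.Properties as ℚ
  open import Data.Rational.Unnormalised as ℚᵘ using (mkℚᵘ; *≡*)
  import Data.Rational.Unnormalised.Properties as ℚᵘ
  open import Data.Rational.Solver using (module +-*-Solver)
  open +-*-Solver using (solve; _:=_; _:+_; _:*_; con)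

  ι : ℕ → ℚ
  ι n = + n / 1

  module _ where
    open import Relation.Binary.Reasoning.Setoid ℚᵘ.≃-setoid

    ι-+ : ∀ a b → ι (a ℕ.+ b) ≡ ι a + ι b
    ι-+ a b = ℚ.toℚᵘ-injective (begin
      toℚᵘ (ι (a ℕ.+ b))            ≈⟨ ℚ.toℚᵘ-fromℚᵘ (mkℚᵘ (+ (a ℕ.+ b)) 0) ⟩
      mkℚᵘ (+ (a ℕ.+ b)) 0          ≈⟨ *≡* (cong₂ (λ x y → (x ℤ.+ y) ℤ.* + 1) (sym (ℤ.*-identityʳ (+ a))) (sym (ℤ.*-identityʳ (+ b)))) ⟩
      mkℚᵘ (+ a) 0 ℚᵘ.+ mkℚᵘ (+ b) 0 ≈⟨ ℚᵘ.+-cong (ℚ.toℚᵘ-fromℚᵘ (mkℚᵘ (+ a) 0)) (ℚ.toℚᵘ-fromℚᵘ (mkℚᵘ (+ b) 0)) ⟨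
      toℚᵘ (ι a) ℚᵘ.+ toℚᵘ (ι b)    ≈⟨ ℚ.toℚᵘ-homo-+ (ι a) (ι b) ⟨
      toℚᵘ (ι a + ι b)              ∎)

    ι-* : ∀ a b → ι (a ℕ.* b) ≡ ι a * ι b
    ι-* a b = ℚ.toℚᵘ-injective (begin
      toℚᵘ (ι (a ℕ.* b))            ≈⟨ ℚ.toℚᵘ-fromℚᵘ (mkℚᵘ (+ (a ℕ.* b)) 0) ⟩
      mkℚᵘ (+ (a ℕ.* b)) 0          ≈⟨ *≡* (cong (ℤ._* + 1) (ℤ.pos-* a b)) ⟩
      mkℚᵘ (+ a) 0 ℚᵘ.* mkℚᵘ (+ b) 0 ≈⟨ ℚᵘ.*-cong (ℚ.toℚᵘ-fromℚᵘ (mkℚᵘ (+ a) 0)) (ℚ.toℚᵘ-fromℚᵘ (mkℚᵘ (+ b) 0)) ⟨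
      toℚᵘ (ι a) ℚᵘ.* toℚᵘ (ι b)    ≈⟨ ℚ.toℚᵘ-homo-* (ι a) (ι b) ⟨
      toℚᵘ (ι a * ι b)              ∎)

    ι-*-/ : ∀ a d .{{_ : ℕ.NonZero d}} → ι d * (+ a / d) ≡ ι a
    ι-*-/ a d@(suc d-1) = ℚ.toℚᵘ-injective (begin
      toℚᵘ (ι d * (+ a / d))         ≈⟨ ℚ.toℚᵘ-homo-* (ι d) (+ a / d) ⟩
      toℚᵘ (ι d) ℚᵘ.* toℚᵘ (+ a / d) ≈⟨ ℚᵘ.*-cong (ℚ.toℚᵘ-fromℚᵘ (mkℚᵘ (+ d) 0)) (ℚ.toℚᵘ-fromℚᵘ (mkℚᵘ (+ a) d-1)) ⟩
      mkℚᵘ (+ d) 0 ℚᵘ.* mkℚᵘ (+ a) d-1 ≈⟨ *≡* (trans (ℤ.*-identityʳ _) (trans (ℤ.*-comm (+ d) (+ a)) (cong (λ x → + a ℤ.* + x) (sym (ℕ.*-identityˡ d))))) ⟩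
      mkℚᵘ (+ a) 0                   ≈⟨ ℚ.toℚᵘ-fromℚᵘ (mkℚᵘ (+ a) 0) ⟨
      toℚᵘ (ι a)                     ∎)

  open ≡-Reasoning

  ι-cancelˡ : ∀ d .{{_ : ℕ.NonZero d}} {x y} → ι d * x ≡ ι d * y → x ≡ y
  ι-cancelˡ d {x} {y} eq = begin
    x                     ≡⟨ undo x ⟨
    (+ 1 / d) * (ι d * x) ≡⟨ cong ((+ 1 / d) *_) eq ⟩
    (+ 1 / d) * (ι d * y) ≡⟨ undo y ⟩
    y                     ∎
    where
    undo : ∀ z → (+ 1 / d) * (ι d * z) ≡ z
    undo z = begin
      (+ 1 / d) * (ι d * z) ≡⟨ solve 3 (λ p q z → p :* (q :* z) := (q :* p) :* z) refl (+ 1 / d) (ι d) z ⟩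
      (ι d * (+ 1 / d)) * z ≡⟨ cong (_* z) (ι-*-/ 1 d) ⟩
      1ℚ * z                ≡⟨ ℚ.*-identityˡ z ⟩
      z                     ∎

  Σ-cong : ∀ n {f g : ℕ → ℚ} → (∀ i → i ℕ.≤ n → f i ≡ g i) → Σ≤ n f ≡ Σ≤ n g
  Σ-cong zero    eq = eq 0 z≤n
  Σ-cong (suc n) eq = cong₂ _+_ (Σ-cong n λ i i≤n → eq i (ℕ.m≤n⇒m≤1+n i≤n)) (eq (suc n) ℕ.≤-refl)

  Σ-+ : ∀ n (f g : ℕ → ℚ) → Σ≤ n (λ i → f i + g i) ≡ Σ≤ n f + Σ≤ n g
  Σ-+ zero    f g = refl
  Σ-+ (suc n) f g rewrite Σ-+ n f g =
    solve 4 (λ a b c d → (a :+ b) :+ (c :+ d) := (a :+ c) :+ (b :+ d)) refl (Σ≤ n f) (Σ≤ n g) (f (suc n)) (g (suc n))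

  Σ-*ˡ : ∀ n c (f : ℕ → ℚ) → Σ≤ n (λ i → c * f i) ≡ c * Σ≤ n f
  Σ-*ˡ zero    c f = refl
  Σ-*ˡ (suc n) c f rewrite Σ-*ˡ n c f = sym (ℚ.*-distribˡ-+ c (Σ≤ n f) (f (suc n)))

  Σ-zero : ∀ n {f : ℕ → ℚ} → (∀ i → i ℕ.≤ n → f i ≡ 0ℚ) → Σ≤ n f ≡ 0ℚ
  Σ-zero zero    eq = eq 0 z≤n
  Σ-zero (suc n) eq = cong₂ _+_ (Σ-zero n λ i i≤n → eq i (ℕ.m≤n⇒m≤1+n i≤n)) (eq (suc n) ℕ.≤-refl)

  Σ-head : ∀ n (f : ℕ → ℚ) → Σ≤ (suc n) f ≡ f 0 + Σ≤ n (f ∘ suc)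
  Σ-head zero    f = refl
  Σ-head (suc n) f rewrite Σ-head n f = ℚ.+-assoc (f 0) (Σ≤ n (f ∘ suc)) (f (suc (suc n)))

  Σ-swap : ∀ m n (f : ℕ → ℕ → ℚ) → Σ≤ m (λ i → Σ≤ n (f i)) ≡ Σ≤ n (λ j → Σ≤ m (λ i → f i j))
  Σ-swap zero    n f = refl
  Σ-swap (suc m) n f rewrite Σ-swap m n f = sym (Σ-+ n (λ j → Σ≤ m (λ i → f i j)) (f (suc m)))

  Σ-extend : ∀ {m n} (f : ℕ → ℚ) → m ℕ.≤ n → (∀ i → m ℕ.< i → f i ≡ 0ℚ) → Σ≤ n f ≡ Σ≤ m f
  Σ-extend {m} f m≤n vanish = go (ℕ.≤⇒≤′ m≤n)
    where
    go : ∀ {n} → m ℕ.≤′ n → Σ≤ n f ≡ Σ≤ m f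
    go (ℕ.≤′-reflexive refl) = refl
    go (ℕ.≤′-step m≤′n) = trans (cong₂ _+_ (go m≤′n) (vanish _ (s≤s (ℕ.≤′⇒≤ m≤′n)))) (ℚ.+-identityʳ _)

  -- The formal derivative and the Cauchy product.

  D : Series → Series
  D f n = ι (suc n) * f (suc n)

  0S 1S : Series
  0S _ = 0ℚ
  1S zero    = 1ℚ
  1S (suc _) = 0ℚ

  D-cancel : ∀ {f g : Series} n → D f n ≡ D g n → f (suc n) ≡ g (suc n)
  D-cancel n = ι-cancelˡ (suc n)

  ⊛-cong : ∀ n {f f′ g g′ : Series} → (∀ i → i ℕ.≤ n → f i ≡ f′ i) → (∀ i → i ℕ.≤ n → g i ≡ g′ i) →
           (f ⊛ g) n ≡ (f′ ⊛ g′) n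
  ⊛-cong n f≡ g≡ = Σ-cong n λ i i≤n → cong₂ _*_ (f≡ i i≤n) (g≡ (n ∸ i) (ℕ.m∸n≤m n i))

  ⊛-congˡ : ∀ n f {g g′ : Series} → (∀ i → g i ≡ g′ i) → (f ⊛ g) n ≡ (f ⊛ g′) n
  ⊛-congˡ n f g≡ = ⊛-cong n {f = f} (λ _ _ → refl) (λ i _ → g≡ i)

  ⊛-congʳ : ∀ n g {f f′ : Series} → (∀ i → f i ≡ f′ i) → (f ⊛ g) n ≡ (f′ ⊛ g) n
  ⊛-congʳ n g f≡ = ⊛-cong n {g = g} (λ i _ → f≡ i) (λ _ _ → refl)

  ⊛-distribˡ : ∀ f g h n → (f ⊛ (g ⊕ h)) n ≡ (f ⊛ g) n + (f ⊛ h) n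
  ⊛-distribˡ f g h n = trans (Σ-cong n λ i _ → ℚ.*-distribˡ-+ (f i) (g (n ∸ i)) (h (n ∸ i))) (Σ-+ n _ _)

  ⊛-distribʳ : ∀ f g h n → ((f ⊕ g) ⊛ h) n ≡ (f ⊛ h) n + (g ⊛ h) n
  ⊛-distribʳ f g h n = trans (Σ-cong n λ i _ → ℚ.*-distribʳ-+ (h (n ∸ i)) (f i) (g i)) (Σ-+ n _ _)

  ⊛-·ˡ : ∀ c f g n → ((c · f) ⊛ g) n ≡ c * (f ⊛ g) n
  ⊛-·ˡ c f g n = trans (Σ-cong n λ i _ → ℚ.*-assoc c (f i) (g (n ∸ i))) (Σ-*ˡ n c _)

  ⊛-·ʳ : ∀ c f g n → (f ⊛ (c · g)) n ≡ c * (f ⊛ g) n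
  ⊛-·ʳ c f g n = trans (Σ-cong n λ i _ → solve 3 (λ c f g → f :* (c :* g) := c :* (f :* g)) refl c (f i) (g (n ∸ i))) (Σ-*ˡ n c _)

  ⊛-zeroʳ : ∀ f n → (f ⊛ 0S) n ≡ 0ℚ
  ⊛-zeroʳ f n = Σ-zero n λ i _ → ℚ.*-zeroʳ (f i)

  ⊛-zeroˡ : ∀ f n → (0S ⊛ f) n ≡ 0ℚ
  ⊛-zeroˡ f n = Σ-zero n λ i _ → ℚ.*-zeroˡ (f (n ∸ i))

  -- The factor `suc n` splits in each product as `i + (suc n ∸ i)`. The first share vanishes at
  -- `i = 0` and the second at `i = suc n`, so each sum reindexes to a convolution at `n`.
  leibniz : ∀ f g n → D (f ⊛ g) n ≡ (D f ⊛ g) n + (f ⊛ D g) n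
  leibniz f g n = begin
    ι (suc n) * Σ≤ (suc n) (λ i → f i * g (suc n ∸ i))
      ≡⟨ Σ-*ˡ (suc n) (ι (suc n)) _ ⟨
    Σ≤ (suc n) (λ i → ι (suc n) * (f i * g (suc n ∸ i)))
      ≡⟨ Σ-cong (suc n) split ⟩
    Σ≤ (suc n) (λ i → left i + right i)
      ≡⟨ Σ-+ (suc n) left right ⟩
    Σ≤ (suc n) left + Σ≤ (suc n) right
      ≡⟨ cong₂ _+_ sumLeft sumRight ⟩
    (D f ⊛ g) n + (f ⊛ D g) n ∎
    where
    left right : ℕ → ℚ
    left  i = (ι i * f i) * g (suc n ∸ i)
    right i = f i * (ι (suc n ∸ i) * g (suc n ∸ i))

    split : ∀ i → i ℕ.≤ suc n → ι (suc n) * (f i * g (suc n ∸ i)) ≡ left i + right i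
    split i i≤ = begin
      ι (suc n) * (f i * g (suc n ∸ i))
        ≡⟨ cong (λ k → ι k * (f i * g (suc n ∸ i))) (ℕ.m+[n∸m]≡n i≤) ⟨
      ι (i ℕ.+ (suc n ∸ i)) * (f i * g (suc n ∸ i))
        ≡⟨ cong (_* (f i * g (suc n ∸ i))) (ι-+ i (suc n ∸ i)) ⟩
      (ι i + ι (suc n ∸ i)) * (f i * g (suc n ∸ i))
        ≡⟨ solve 4 (λ a b x y → (a :+ b) :* (x :* y) := (a :* x) :* y :+ x :* (b :* y)) refl (ι i) (ι (suc n ∸ i)) (f i) (g (suc n ∸ i)) ⟩
      left i + right i ∎

    sumLeft : Σ≤ (suc n) left ≡ (D f ⊛ g) n
    sumLeft = begin
      Σ≤ (suc n) left                                 ≡⟨ Σ-head n left ⟩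
      (0ℚ * f 0) * g (suc n) + (D f ⊛ g) n             ≡⟨ solve 3 (λ x y z → (con 0ℚ :* x) :* y :+ z := z) refl (f 0) (g (suc n)) ((D f ⊛ g) n) ⟩
      (D f ⊛ g) n                                     ∎

    sumRight : Σ≤ (suc n) right ≡ (f ⊛ D g) n
    sumRight = begin
      Σ≤ n right + right (suc n)
        ≡⟨ cong₂ _+_ (Σ-cong n λ i i≤n → cong (λ k → f i * (ι k * g k)) (ℕ.+-∸-assoc 1 i≤n))
                     (cong (λ k → f (suc n) * (ι k * g k)) (ℕ.n∸n≡0 n)) ⟩
      (f ⊛ D g) n + f (suc n) * (0ℚ * g 0)
        ≡⟨ solve 3 (λ x y z → z :+ x :* (con 0ℚ :* y) := z) refl (f (suc n)) (g 0) ((f ⊛ D g) n) ⟩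
      (f ⊛ D g) n ∎

  -- A coefficient identity that holds at 0 and is stable under D holds everywhere; hence the
  -- ring laws of ⊛ follow from the Leibniz rule.
  ⊛-comm : ∀ n f g → (f ⊛ g) n ≡ (g ⊛ f) n
  ⊛-comm zero    f g = ℚ.*-comm (f 0) (g 0)
  ⊛-comm (suc n) f g = D-cancel {f ⊛ g} {g ⊛ f} n (begin
    D (f ⊛ g) n               ≡⟨ leibniz f g n ⟩
    (D f ⊛ g) n + (f ⊛ D g) n ≡⟨ cong₂ _+_ (⊛-comm n (D f) g) (⊛-comm n f (D g)) ⟩
    (g ⊛ D f) n + (D g ⊛ f) n ≡⟨ ℚ.+-comm ((g ⊛ D f) n) ((D g ⊛ f) n) ⟩
    (D g ⊛ f) n + (g ⊛ D f) n ≡⟨ leibniz g f n ⟨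
    D (g ⊛ f) n               ∎)

  ⊛-assoc : ∀ n f g h → ((f ⊛ g) ⊛ h) n ≡ (f ⊛ (g ⊛ h)) n
  ⊛-assoc zero    f g h = ℚ.*-assoc (f 0) (g 0) (h 0)
  ⊛-assoc (suc n) f g h = D-cancel {(f ⊛ g) ⊛ h} {f ⊛ (g ⊛ h)} n (begin
    D ((f ⊛ g) ⊛ h) n
      ≡⟨ leibniz (f ⊛ g) h n ⟩
    (D (f ⊛ g) ⊛ h) n + ((f ⊛ g) ⊛ D h) n
      ≡⟨ cong (_+ ((f ⊛ g) ⊛ D h) n) (trans (⊛-congʳ n h (leibniz f g)) (⊛-distribʳ (D f ⊛ g) (f ⊛ D g) h n)) ⟩
    (((D f ⊛ g) ⊛ h) n + ((f ⊛ D g) ⊛ h) n) + ((f ⊛ g) ⊛ D h) n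
      ≡⟨ cong₂ _+_ (cong₂ _+_ (⊛-assoc n (D f) g h) (⊛-assoc n f (D g) h)) (⊛-assoc n f g (D h)) ⟩
    ((D f ⊛ (g ⊛ h)) n + (f ⊛ (D g ⊛ h)) n) + (f ⊛ (g ⊛ D h)) n
      ≡⟨ ℚ.+-assoc ((D f ⊛ (g ⊛ h)) n) _ _ ⟩
    (D f ⊛ (g ⊛ h)) n + ((f ⊛ (D g ⊛ h)) n + (f ⊛ (g ⊛ D h)) n)
      ≡⟨ cong (λ x → (D f ⊛ (g ⊛ h)) n + x) (trans (⊛-congˡ n f (leibniz g h)) (⊛-distribˡ f (D g ⊛ h) (g ⊛ D h) n)) ⟨
    (D f ⊛ (g ⊛ h)) n + (f ⊛ D (g ⊛ h)) n
      ≡⟨ leibniz f (g ⊛ h) n ⟨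
    D (f ⊛ (g ⊛ h)) n ∎)

  ⊛-leftComm : ∀ n f g h → (f ⊛ (g ⊛ h)) n ≡ (g ⊛ (f ⊛ h)) n
  ⊛-leftComm n f g h = begin
    (f ⊛ (g ⊛ h)) n ≡⟨ ⊛-assoc n f g h ⟨
    ((f ⊛ g) ⊛ h) n ≡⟨ ⊛-congʳ n h (λ i → ⊛-comm i f g) ⟩
    ((g ⊛ f) ⊛ h) n ≡⟨ ⊛-assoc n g f h ⟩
    (g ⊛ (f ⊛ h)) n ∎

  D-1S : ∀ n → D 1S n ≡ 0ℚ
  D-1S n = ℚ.*-zeroʳ (ι (suc n))

  ⊛-identityˡ : ∀ n f → (1S ⊛ f) n ≡ f n
  ⊛-identityˡ zero    f = ℚ.*-identityˡ (f 0)
  ⊛-identityˡ (suc n) f = D-cancel {1S ⊛ f} {f} n (begin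
    D (1S ⊛ f) n                ≡⟨ leibniz 1S f n ⟩
    (D 1S ⊛ f) n + (1S ⊛ D f) n ≡⟨ cong₂ _+_ (trans (⊛-congʳ n f D-1S) (⊛-zeroˡ f n)) (⊛-identityˡ n (D f)) ⟩
    0ℚ + D f n                  ≡⟨ ℚ.+-identityˡ (D f n) ⟩
    D f n                       ∎)

  D-^S : ∀ f j n → D (f ^S suc j) n ≡ ι (suc j) * (D f ⊛ (f ^S j)) n
  D-^S f zero n = begin
    D (f ⊛ (f ^S 0)) n                      ≡⟨ leibniz f (f ^S 0) n ⟩
    (D f ⊛ (f ^S 0)) n + (f ⊛ D (f ^S 0)) n ≡⟨ cong (λ x → (D f ⊛ (f ^S 0)) n + x) (trans (⊛-congˡ n f λ i → D-1S i) (⊛-zeroʳ f n)) ⟩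
    (D f ⊛ (f ^S 0)) n + 0ℚ                 ≡⟨ solve 1 (λ x → x :+ con 0ℚ := con 1ℚ :* x) refl ((D f ⊛ (f ^S 0)) n) ⟩
    1ℚ * (D f ⊛ (f ^S 0)) n                 ∎
  D-^S f (suc j) n = begin
    D (f ⊛ p) n
      ≡⟨ leibniz f p n ⟩
    (D f ⊛ p) n + (f ⊛ D p) n
      ≡⟨ cong (λ x → (D f ⊛ p) n + x) (trans (⊛-congˡ n f (D-^S f j)) (⊛-·ʳ (ι (suc j)) f (D f ⊛ (f ^S j)) n)) ⟩
    (D f ⊛ p) n + ι (suc j) * (f ⊛ (D f ⊛ (f ^S j))) n
      ≡⟨ cong (λ x → (D f ⊛ p) n + ι (suc j) * x) (⊛-leftComm n f (D f) (f ^S j)) ⟩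
    (D f ⊛ p) n + ι (suc j) * (D f ⊛ p) n
      ≡⟨ solve 2 (λ x k → x :+ k :* x := (con 1ℚ :+ k) :* x) refl ((D f ⊛ p) n) (ι (suc j)) ⟩
    (1ℚ + ι (suc j)) * (D f ⊛ p) n
      ≡⟨ cong (_* (D f ⊛ p) n) (ι-+ 1 (suc j)) ⟨
    ι (suc (suc j)) * (D f ⊛ p) n ∎
    where p = f ^S suc j

  ^S-vanish : ∀ {f} → f 0 ≡ 0ℚ → ∀ j n → n ℕ.< j → (f ^S j) n ≡ 0ℚ
  ^S-vanish {f} f0 (suc j) n n<j = Σ-zero n λ where
    zero    _   → trans (cong (_* (f ^S j) n) f0) (ℚ.*-zeroˡ ((f ^S j) n))
    (suc i) i<n → trans (cong (f (suc i) *_) (^S-vanish f0 j (n ∸ suc i)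
      (ℕ.<-≤-trans (ℕ.∸-monoʳ-< (ℕ.z<s {i}) i<n) (ℕ.≤-pred n<j)))) (ℚ.*-zeroʳ (f (suc i)))

  -- The exponential of a series and the derivative of `F`.

  invFact : ℕ → ℚ
  invFact j = (+ 1 / (j !)) {{j ℕ.!≢0}}

  invFact-suc : ∀ j → ι (suc j) * invFact (suc j) ≡ invFact j
  invFact-suc j = ι-cancelˡ (j !) {{j ℕ.!≢0}} (begin
    ι (j !) * (ι (suc j) * invFact (suc j)) ≡⟨ solve 3 (λ a b x → a :* (b :* x) := (b :* a) :* x) refl (ι (j !)) (ι (suc j)) (invFact (suc j)) ⟩
    (ι (suc j) * ι (j !)) * invFact (suc j) ≡⟨ cong (_* invFact (suc j)) (ι-* (suc j) (j !)) ⟨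
    ι (suc j !) * invFact (suc j)           ≡⟨ ι-*-/ 1 (suc j !) {{suc j ℕ.!≢0}} ⟩
    ι 1                                     ≡⟨ ι-*-/ 1 (j !) {{j ℕ.!≢0}} ⟨
    ι (j !) * invFact j                     ∎)

  -- The term `j = 0` is constant, and the others lose one power of `f` and one factor of `j !`.
  -- After the sums are exchanged, the inner sum runs up to `n` where `expS f (n ∸ i)` stops at
  -- `n ∸ i`; the surplus terms vanish because `f` has no constant term.
  D-expS : ∀ {f} → f 0 ≡ 0ℚ → ∀ n → D (expS f) n ≡ (D f ⊛ expS f) n
  D-expS {f} f0 n = begin
    ι (suc n) * Σ≤ (suc n) (λ j → (f ^S j) (suc n) * invFact j)
      ≡⟨ cong (ι (suc n) *_) (trans (Σ-head n _) (trans (cong (_+ Σ≤ n (λ j → (f ^S suc j) (suc n) * invFact (suc j))) (ℚ.*-zeroˡ (invFact 0))) (ℚ.+-identityˡ _))) ⟩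
    ι (suc n) * Σ≤ n (λ j → (f ^S suc j) (suc n) * invFact (suc j))
      ≡⟨ Σ-*ˡ n (ι (suc n)) _ ⟨
    Σ≤ n (λ j → ι (suc n) * ((f ^S suc j) (suc n) * invFact (suc j)))
      ≡⟨ Σ-cong n (λ j _ → term j) ⟩
    Σ≤ n (λ j → Σ≤ n (λ i → D f i * ((f ^S j) (n ∸ i) * invFact j)))
      ≡⟨ Σ-swap n n _ ⟩
    Σ≤ n (λ i → Σ≤ n (λ j → D f i * ((f ^S j) (n ∸ i) * invFact j)))
      ≡⟨ Σ-cong n (λ i _ → trans (Σ-*ˡ n (D f i) _) (cong (D f i *_) (truncate i))) ⟩
    (D f ⊛ expS f) n ∎
    where
    term : ∀ j → ι (suc n) * ((f ^S suc j) (suc n) * invFact (suc j)) ≡ Σ≤ n (λ i → D f i * ((f ^S j) (n ∸ i) * invFact j))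
    term j = begin
      ι (suc n) * ((f ^S suc j) (suc n) * invFact (suc j))
        ≡⟨ ℚ.*-assoc (ι (suc n)) _ _ ⟨
      D (f ^S suc j) n * invFact (suc j)
        ≡⟨ cong (_* invFact (suc j)) (D-^S f j n) ⟩
      (ι (suc j) * (D f ⊛ (f ^S j)) n) * invFact (suc j)
        ≡⟨ solve 3 (λ k x y → (k :* x) :* y := (k :* y) :* x) refl (ι (suc j)) ((D f ⊛ (f ^S j)) n) (invFact (suc j)) ⟩
      (ι (suc j) * invFact (suc j)) * (D f ⊛ (f ^S j)) n
        ≡⟨ cong (_* (D f ⊛ (f ^S j)) n) (invFact-suc j) ⟩
      invFact j * (D f ⊛ (f ^S j)) n
        ≡⟨ Σ-*ˡ n (invFact j) _ ⟨
      Σ≤ n (λ i → invFact j * (D f i * (f ^S j) (n ∸ i)))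
        ≡⟨ Σ-cong n (λ i _ → solve 3 (λ c x y → c :* (x :* y) := x :* (y :* c)) refl (invFact j) (D f i) ((f ^S j) (n ∸ i))) ⟩
      Σ≤ n (λ i → D f i * ((f ^S j) (n ∸ i) * invFact j)) ∎

    truncate : ∀ i → Σ≤ n (λ j → (f ^S j) (n ∸ i) * invFact j) ≡ expS f (n ∸ i)
    truncate i = Σ-extend _ (ℕ.m∸n≤m n i) λ j n∸i<j →
      trans (cong (_* invFact j) (^S-vanish f0 j (n ∸ i) n∸i<j)) (ℚ.*-zeroˡ (invFact j))

  D-expLin : ∀ c n → D (expLin c) n ≡ ι c * expLin c n
  D-expLin c n = ι-cancelˡ (n !) {{n ℕ.!≢0}} (begin
    ι (n !) * (ι (suc n) * expLin c (suc n)) ≡⟨ solve 3 (λ a b x → a :* (b :* x) := (b :* a) :* x) refl (ι (n !)) (ι (suc n)) (expLin c (suc n)) ⟩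
    (ι (suc n) * ι (n !)) * expLin c (suc n) ≡⟨ cong (_* expLin c (suc n)) (ι-* (suc n) (n !)) ⟨
    ι (suc n !) * expLin c (suc n)           ≡⟨ ι-*-/ (c ℕ.^ suc n) (suc n !) {{suc n ℕ.!≢0}} ⟩
    ι (c ℕ.* c ℕ.^ n)                        ≡⟨ ι-* c (c ℕ.^ n) ⟩
    ι c * ι (c ℕ.^ n)                        ≡⟨ cong (ι c *_) (ι-*-/ (c ℕ.^ n) (n !) {{n ℕ.!≢0}}) ⟨
    ι c * (ι (n !) * expLin c n)             ≡⟨ solve 3 (λ a b x → a :* (b :* x) := b :* (a :* x)) refl (ι c) (ι (n !)) (expLin c n) ⟩
    ι (n !) * (ι c * expLin c n)             ∎)

  -- Both sides solve y′ = 2y with the same constant term.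
  expLin-⊛ : ∀ n → (expLin 1 ⊛ expLin 1) n ≡ expLin 2 n
  expLin-⊛ zero    = refl
  expLin-⊛ (suc n) = D-cancel {expLin 1 ⊛ expLin 1} {expLin 2} n (begin
    D (expLin 1 ⊛ expLin 1) n
      ≡⟨ leibniz (expLin 1) (expLin 1) n ⟩
    (D (expLin 1) ⊛ expLin 1) n + (expLin 1 ⊛ D (expLin 1)) n
      ≡⟨ cong₂ _+_ (⊛-congʳ n (expLin 1) D-e) (⊛-congˡ n (expLin 1) D-e) ⟩
    (expLin 1 ⊛ expLin 1) n + (expLin 1 ⊛ expLin 1) n
      ≡⟨ cong₂ _+_ (expLin-⊛ n) (expLin-⊛ n) ⟩
    expLin 2 n + expLin 2 n
      ≡⟨ solve 1 (λ x → x :+ x := con (ι 2) :* x) refl (expLin 2 n) ⟩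
    ι 2 * expLin 2 n
      ≡⟨ D-expLin 2 n ⟨
    D (expLin 2) n ∎)
    where
    D-e : ∀ i → D (expLin 1) i ≡ expLin 1 i
    D-e i = trans (D-expLin 1 i) (ℚ.*-identityˡ (expLin 1 i))

  expLin≡1+expm1 : ∀ n → expLin 1 n ≡ 1S n + expm1 n
  expLin≡1+expm1 zero    = refl
  expLin≡1+expm1 (suc n) = sym (ℚ.+-identityˡ (expm1 (suc n)))

  D-expm1 : ∀ n → D expm1 n ≡ expLin 1 n
  D-expm1 n = trans (D-expLin 1 n) (ℚ.*-identityˡ (expLin 1 n))

  expLin-⊛-expm1 : ∀ n → expLin 1 n + (expLin 1 ⊛ expm1) n ≡ expLin 2 n
  expLin-⊛-expm1 n = begin
    expLin 1 n + (expLin 1 ⊛ expm1) n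
      ≡⟨ cong (_+ (expLin 1 ⊛ expm1) n) (trans (⊛-comm n (expLin 1) 1S) (⊛-identityˡ n (expLin 1))) ⟨
    (expLin 1 ⊛ 1S) n + (expLin 1 ⊛ expm1) n
      ≡⟨ ⊛-distribˡ (expLin 1) 1S expm1 n ⟨
    (expLin 1 ⊛ (1S ⊕ expm1)) n
      ≡⟨ ⊛-congˡ n (expLin 1) expLin≡1+expm1 ⟨
    (expLin 1 ⊛ expLin 1) n
      ≡⟨ expLin-⊛ n ⟩
    expLin 2 n ∎

  D-zS : ∀ n → D zS n ≡ 1S n
  D-zS zero    = refl
  D-zS (suc n) = ℚ.*-zeroʳ (ι (suc (suc n)))

  D-z⊛expLin2 : ∀ n → D (zS ⊛ expLin 2) n ≡ expLin 2 n + ι 2 * (zS ⊛ expLin 2) n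
  D-z⊛expLin2 n = begin
    D (zS ⊛ expLin 2) n
      ≡⟨ leibniz zS (expLin 2) n ⟩
    (D zS ⊛ expLin 2) n + (zS ⊛ D (expLin 2)) n
      ≡⟨ cong₂ _+_ (trans (⊛-congʳ n (expLin 2) D-zS) (⊛-identityˡ n (expLin 2)))
                   (trans (⊛-congˡ n zS (D-expLin 2)) (⊛-·ʳ (ι 2) zS (expLin 2) n)) ⟩
    expLin 2 n + ι 2 * (zS ⊛ expLin 2) n ∎

  -- The half square has derivative e^z (e^z - 1), which absorbs one of the two copies of e^z coming
  -- from 2(e^z - 1) and becomes e^{2z}. The second e^{2z} comes from z e^{2z}.
  D-F : ∀ n → D F n ≡ (expLin 1 n + (expLin 2 n + expLin 2 n)) + ι 2 * (zS ⊛ expLin 2) n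
  D-F n = begin
    ι (suc n) * (ι 2 * expm1 (suc n) + ((+ 1 / 2) * (expm1 ⊛ expm1) (suc n) + (zS ⊛ expLin 2) (suc n)))
      ≡⟨ solve 4 (λ k a b c → k :* (con (ι 2) :* a :+ (con (+ 1 / 2) :* b :+ c)) :=
                              con (ι 2) :* (k :* a) :+ (con (+ 1 / 2) :* (k :* b) :+ k :* c)) refl
           (ι (suc n)) (expm1 (suc n)) ((expm1 ⊛ expm1) (suc n)) ((zS ⊛ expLin 2) (suc n)) ⟩
    ι 2 * D expm1 n + ((+ 1 / 2) * D (expm1 ⊛ expm1) n + D (zS ⊛ expLin 2) n)
      ≡⟨ cong₂ (λ x y → ι 2 * x + ((+ 1 / 2) * y + D (zS ⊛ expLin 2) n)) (D-expm1 n) square ⟩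
    ι 2 * e₁ + ((+ 1 / 2) * (e₁m + e₁m) + D (zS ⊛ expLin 2) n)
      ≡⟨ cong (λ x → ι 2 * e₁ + ((+ 1 / 2) * (e₁m + e₁m) + x)) (D-z⊛expLin2 n) ⟩
    ι 2 * e₁ + ((+ 1 / 2) * (e₁m + e₁m) + (e₂ + ι 2 * ze₂))
      ≡⟨ solve 4 (λ a b c d → con (ι 2) :* a :+ (con (+ 1 / 2) :* (b :+ b) :+ (c :+ con (ι 2) :* d)) :=
                              (a :+ ((a :+ b) :+ c)) :+ con (ι 2) :* d) refl e₁ e₁m e₂ ze₂ ⟩
    (e₁ + ((e₁ + e₁m) + e₂)) + ι 2 * ze₂
      ≡⟨ cong (λ x → (e₁ + (x + e₂)) + ι 2 * ze₂) (expLin-⊛-expm1 n) ⟩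
    (e₁ + (e₂ + e₂)) + ι 2 * ze₂ ∎
    where
    e₁ = expLin 1 n
    e₂ = expLin 2 n
    e₁m = (expLin 1 ⊛ expm1) n
    ze₂ = (zS ⊛ expLin 2) n

    square : D (expm1 ⊛ expm1) n ≡ e₁m + e₁m
    square = trans (leibniz expm1 expm1 n) (cong₂ _+_
      (⊛-congʳ n expm1 D-expm1)
      (trans (⊛-comm n expm1 (D expm1)) (⊛-congʳ n expm1 D-expm1)))

  D-EGF : ∀ n → D EGF n ≡
    ((expLin 1 ⊛ EGF) n + ((expLin 2 ⊛ EGF) n + (expLin 2 ⊛ EGF) n)) + ((ι 2 · (zS ⊛ expLin 2)) ⊛ EGF) n
  D-EGF n = begin
    D EGF n
      ≡⟨ D-expS {F} refl n ⟩
    (D F ⊛ EGF) n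
      ≡⟨ ⊛-congʳ n EGF D-F ⟩
    (((expLin 1 ⊕ (expLin 2 ⊕ expLin 2)) ⊕ (ι 2 · (zS ⊛ expLin 2))) ⊛ EGF) n
      ≡⟨ ⊛-distribʳ (expLin 1 ⊕ (expLin 2 ⊕ expLin 2)) (ι 2 · (zS ⊛ expLin 2)) EGF n ⟩
    ((expLin 1 ⊕ (expLin 2 ⊕ expLin 2)) ⊛ EGF) n + ((ι 2 · (zS ⊛ expLin 2)) ⊛ EGF) n
      ≡⟨ cong (_+ ((ι 2 · (zS ⊛ expLin 2)) ⊛ EGF) n)
           (trans (⊛-distribʳ (expLin 1) (expLin 2 ⊕ expLin 2) EGF n)
                  (cong (λ x → (expLin 1 ⊛ EGF) n + x) (⊛-distribʳ (expLin 2) (expLin 2) EGF n))) ⟩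
    ((expLin 1 ⊛ EGF) n + ((expLin 2 ⊛ EGF) n + (expLin 2 ⊛ EGF) n)) + ((ι 2 · (zS ⊛ expLin 2)) ⊛ EGF) n ∎

  -- Generating functions of the counting recursions.

  -- If g has exponential generating function G, then partCount w g and pointedCount g have
  -- exponential generating functions e^{wz} G and 2z e^{2z} G.
  partCount : ℕ → ℕ → (ℕ → ℕ) → ℕ
  partCount w zero    g = g 0
  partCount w (suc n) g = w ℕ.* partCount w n g ℕ.+ partCount w n (g ∘ suc)

  pointedCount : ℕ → (ℕ → ℕ) → ℕ
  pointedCount zero    g = 0
  pointedCount (suc n) g = 2 ℕ.* (partCount 2 n g ℕ.+ pointedCount n g) ℕ.+ pointedCount n (g ∘ suc)

  -- The bound is there because `codeCount k` has the intended values only below its fuel. As a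
  -- record, the property lets `g` and `G` be inferred from its proofs.
  record HasEGF≤ (n : ℕ) (g : ℕ → ℕ) (G : Series) : Set where
    field coeff : ∀ r → r ℕ.≤ n → ι (g r) ≡ ι (r !) * G r
  open HasEGF≤

  fact-suc : ∀ n x → ι (suc n !) * x ≡ ι (n !) * (ι (suc n) * x)
  fact-suc n x = begin
    ι (suc n !) * x           ≡⟨ cong (_* x) (ι-* (suc n) (n !)) ⟩
    (ι (suc n) * ι (n !)) * x ≡⟨ solve 3 (λ a b x → (a :* b) :* x := b :* (a :* x)) refl (ι (suc n)) (ι (n !)) x ⟩
    ι (n !) * (ι (suc n) * x) ∎

  -- For exponential generating functions the derivative is the shift of the sequence. This matches
  -- the `g ∘ suc` of the recursions with the second term of the Leibniz rule.
  HasEGF≤-shift : ∀ {n g G} → HasEGF≤ (suc n) g G → HasEGF≤ n (g ∘ suc) (D G)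
  HasEGF≤-shift {G = G} p .coeff r r≤n = trans (p .coeff (suc r) (s≤s r≤n)) (fact-suc r (G (suc r)))

  HasEGF≤-weaken : ∀ {n g G} → HasEGF≤ (suc n) g G → HasEGF≤ n g G
  HasEGF≤-weaken p .coeff r r≤n = p .coeff r (ℕ.m≤n⇒m≤1+n r≤n)

  -- The two summands of the recursion are the two terms of (e^{wz} G)′ = w e^{wz} G + e^{wz} G′.
  partCount-egf : ∀ w n {g G} → HasEGF≤ n g G → ι (partCount w n g) ≡ ι (n !) * (expLin w ⊛ G) n
  partCount-egf w zero {g} {G} p = trans (p .coeff 0 z≤n) (cong (ι 1 *_) (sym (ℚ.*-identityˡ (G 0))))
  partCount-egf w (suc n) {g} {G} p = begin
    ι (w ℕ.* partCount w n g ℕ.+ partCount w n (g ∘ suc))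
      ≡⟨ trans (ι-+ (w ℕ.* partCount w n g) _) (cong (_+ ι (partCount w n (g ∘ suc))) (ι-* w (partCount w n g))) ⟩
    ι w * ι (partCount w n g) + ι (partCount w n (g ∘ suc))
      ≡⟨ cong₂ (λ x y → ι w * x + y) (partCount-egf w n (HasEGF≤-weaken p)) (partCount-egf w n (HasEGF≤-shift p)) ⟩
    ι w * (ι (n !) * (expLin w ⊛ G) n) + ι (n !) * (expLin w ⊛ D G) n
      ≡⟨ solve 4 (λ a b x y → a :* (b :* x) :+ b :* y := b :* (a :* x :+ y)) refl (ι w) (ι (n !)) ((expLin w ⊛ G) n) ((expLin w ⊛ D G) n) ⟩
    ι (n !) * (ι w * (expLin w ⊛ G) n + (expLin w ⊛ D G) n)
      ≡⟨ cong (λ x → ι (n !) * (x + (expLin w ⊛ D G) n)) (trans (⊛-congʳ n G (D-expLin w)) (⊛-·ˡ (ι w) (expLin w) G n)) ⟨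
    ι (n !) * ((D (expLin w) ⊛ G) n + (expLin w ⊛ D G) n)
      ≡⟨ cong (ι (n !) *_) (leibniz (expLin w) G n) ⟨
    ι (n !) * D (expLin w ⊛ G) n
      ≡⟨ fact-suc n ((expLin w ⊛ G) (suc n)) ⟨
    ι (suc n !) * (expLin w ⊛ G) (suc n) ∎

  2ze²ᶻ : Series
  2ze²ᶻ = ι 2 · (zS ⊛ expLin 2)

  D-2ze²ᶻ : ∀ n → D 2ze²ᶻ n ≡ ι 2 * (expLin 2 n + 2ze²ᶻ n)
  D-2ze²ᶻ n = begin
    ι (suc n) * (ι 2 * (zS ⊛ expLin 2) (suc n)) ≡⟨ solve 3 (λ a b x → a :* (b :* x) := b :* (a :* x)) refl (ι (suc n)) (ι 2) ((zS ⊛ expLin 2) (suc n)) ⟩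
    ι 2 * D (zS ⊛ expLin 2) n                   ≡⟨ cong (ι 2 *_) (D-z⊛expLin2 n) ⟩
    ι 2 * (expLin 2 n + 2ze²ᶻ n)                ∎

  -- Again the Leibniz rule, now with (2z e^{2z})′ = 2(e^{2z} + 2z e^{2z}): an orbit that joins the
  -- block on one of two sides either is the marked one or leaves the mark to a later orbit.
  pointedCount-egf : ∀ n {g G} → HasEGF≤ n g G → ι (pointedCount n g) ≡ ι (n !) * (2ze²ᶻ ⊛ G) n
  pointedCount-egf zero {g} {G} p = solve 1 (λ x → con 0ℚ := con 1ℚ :* (con 0ℚ :* x)) refl (G 0)
  pointedCount-egf (suc n) {g} {G} p = begin
    ι (2 ℕ.* (b ℕ.+ m) ℕ.+ m′)
      ≡⟨ trans (ι-+ (2 ℕ.* (b ℕ.+ m)) m′) (cong (_+ ι m′) (trans (ι-* 2 (b ℕ.+ m)) (cong (ι 2 *_) (ι-+ b m)))) ⟩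
    ι 2 * (ι b + ι m) + ι m′
      ≡⟨ cong₂ _+_ (cong₂ (λ x y → ι 2 * (x + y)) (partCount-egf 2 n (HasEGF≤-weaken p)) (pointedCount-egf n (HasEGF≤-weaken p)))
                   (pointedCount-egf n (HasEGF≤-shift p)) ⟩
    ι 2 * (ι (n !) * (expLin 2 ⊛ G) n + ι (n !) * (2ze²ᶻ ⊛ G) n) + ι (n !) * (2ze²ᶻ ⊛ D G) n
      ≡⟨ solve 5 (λ t a x y z → t :* (a :* x :+ a :* y) :+ a :* z := a :* (t :* (x :+ y) :+ z)) refl
           (ι 2) (ι (n !)) ((expLin 2 ⊛ G) n) ((2ze²ᶻ ⊛ G) n) ((2ze²ᶻ ⊛ D G) n) ⟩
    ι (n !) * (ι 2 * ((expLin 2 ⊛ G) n + (2ze²ᶻ ⊛ G) n) + (2ze²ᶻ ⊛ D G) n)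
      ≡⟨ cong (λ x → ι (n !) * (x + (2ze²ᶻ ⊛ D G) n)) derivative ⟨
    ι (n !) * ((D 2ze²ᶻ ⊛ G) n + (2ze²ᶻ ⊛ D G) n)
      ≡⟨ cong (ι (n !) *_) (leibniz 2ze²ᶻ G n) ⟨
    ι (n !) * D (2ze²ᶻ ⊛ G) n
      ≡⟨ fact-suc n ((2ze²ᶻ ⊛ G) (suc n)) ⟨
    ι (suc n !) * (2ze²ᶻ ⊛ G) (suc n) ∎
    where
    b = partCount 2 n g
    m = pointedCount n g
    m′ = pointedCount n (g ∘ suc)

    derivative : (D 2ze²ᶻ ⊛ G) n ≡ ι 2 * ((expLin 2 ⊛ G) n + (2ze²ᶻ ⊛ G) n)
    derivative = begin
      (D 2ze²ᶻ ⊛ G) n                              ≡⟨ ⊛-congʳ n G D-2ze²ᶻ ⟩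
      ((ι 2 · (expLin 2 ⊕ 2ze²ᶻ)) ⊛ G) n           ≡⟨ ⊛-·ˡ (ι 2) (expLin 2 ⊕ 2ze²ᶻ) G n ⟩
      ι 2 * ((expLin 2 ⊕ 2ze²ᶻ) ⊛ G) n             ≡⟨ cong (ι 2 *_) (⊛-distribʳ (expLin 2) 2ze²ᶻ G n) ⟩
      ι 2 * ((expLin 2 ⊛ G) n + (2ze²ᶻ ⊛ G) n)     ∎

  -- The first argument is fuel; the value is the intended one when it exceeds the second.
  codeCount : ℕ → ℕ → ℕ
  codeCount zero    _       = 0
  codeCount (suc k) zero    = 1
  codeCount (suc k) (suc n) =
    partCount 1 n (codeCount k) ℕ.+ (partCount 2 n (codeCount k) ℕ.+ (partCount 2 n (codeCount k) ℕ.+ pointedCount n (codeCount k)))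

  -- The four summands are the four terms of `D-EGF`, whose coefficient at `n` determines `EGF` at
  -- `suc n` from its values up to `n`.
  codeCount-egf : ∀ k n → n ℕ.< k → ι (codeCount k n) ≡ ι (n !) * EGF n
  codeCount-egf (suc k) zero    _         = refl
  codeCount-egf (suc k) (suc n) (s≤s n<k) = begin
    ι (p₁ ℕ.+ (p₂ ℕ.+ (p₂ ℕ.+ m)))
      ≡⟨ trans (ι-+ p₁ _) (cong (λ x → ι p₁ + x) (trans (ι-+ p₂ _) (cong (λ x → ι p₂ + x) (ι-+ p₂ m)))) ⟩
    ι p₁ + (ι p₂ + (ι p₂ + ι m))
      ≡⟨ cong₂ (λ x y → x + (y + (y + ι m))) (partCount-egf 1 n ih) (partCount-egf 2 n ih) ⟩
    ι (n !) * s₁ + (ι (n !) * s₂ + (ι (n !) * s₂ + ι m))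
      ≡⟨ cong (λ x → ι (n !) * s₁ + (ι (n !) * s₂ + (ι (n !) * s₂ + x))) (pointedCount-egf n ih) ⟩
    ι (n !) * s₁ + (ι (n !) * s₂ + (ι (n !) * s₂ + ι (n !) * s₃))
      ≡⟨ solve 4 (λ a x y z → a :* x :+ (a :* y :+ (a :* y :+ a :* z)) := a :* ((x :+ (y :+ y)) :+ z)) refl (ι (n !)) s₁ s₂ s₃ ⟩
    ι (n !) * ((s₁ + (s₂ + s₂)) + s₃)
      ≡⟨ cong (ι (n !) *_) (D-EGF n) ⟨
    ι (n !) * D EGF n
      ≡⟨ fact-suc n (EGF (suc n)) ⟨
    ι (suc n !) * EGF (suc n) ∎
    where
    p₁ = partCount 1 n (codeCount k)
    p₂ = partCount 2 n (codeCount k)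
    m  = pointedCount n (codeCount k)
    s₁ = (expLin 1 ⊛ EGF) n
    s₂ = (expLin 2 ⊛ EGF) n
    s₃ = (2ze²ᶻ ⊛ EGF) n

    ih : HasEGF≤ n (codeCount k) EGF
    ih .coeff r r≤n = codeCount-egf k r (ℕ.≤-<-trans r≤n n<k)

open PowerSeries using (ι; partCount; pointedCount; codeCount; codeCount-egf)

-- Codes for the fixed arrays

private variable
  n r r′ : ℕ
  A X L : Set

xor-cancelˡ : ∀ s t → s xor (s xor t) ≡ t
xor-cancelˡ s t = trans (sym (xor-assoc s s t)) (cong (_xor t) (xor-same s))

xor-telescope : ∀ s t u → (s xor t) xor (t xor u) ≡ s xor u
xor-telescope s t u = trans (xor-assoc s t (t xor u)) (cong (s xor_) (xor-cancelˡ t u))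

-- On an orbit {x, h x} one point is chosen as (x , false), the other being (x , true). An
-- h-invariant relation is determined by R x y s, which says that (x , false) ~ (y , s).
SRel : Set → Set
SRel X = X → X → Bool → Bool

-- By invariance `R y z t` also says that (y , s) ~ (z , s xor t); this is why signs add in
-- `trans⁺`. In `sym⁺` the sign stays, since reflecting both points moves it from one to the other.
record IsSignedEquivalence (R : SRel X) : Set where
  field
    refl⁺  : ∀ x → R x x false ≡ true
    sym⁺   : ∀ x y s → R x y s ≡ true → R y x s ≡ true
    trans⁺ : ∀ x y z s t → R x y s ≡ true → R y z t ≡ true → R x z (s xor t) ≡ true
open IsSignedEquivalence

-- An invariant set of circled cells is a set of orbits. The clause `s ≡ false` makes the two cells
-- agree and not only their orbits; for `x` and `y` equal it forbids a circle on an invariant block.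
AtMostOneCircle : SRel X → (X → Bool) → Set
AtMostOneCircle R c = ∀ x y s → R x y s ≡ true → c x ≡ true → c y ≡ true → x ≡ y × s ≡ false

-- The n orbits other than the first, r of which do not meet its block; L records how the
-- others meet it.
data Part (L : Set) : ℕ → ℕ → Set where
  []      : Part L 0 0
  outside : Part L n r → Part L (suc n) (suc r)
  inside  : L → Part L n r → Part L (suc n) r

class : Part L n r → Fin n → L ⊎ Fin r
class (outside p)  zero    = inj₂ zero
class (outside p)  (suc x) = map₂ suc (class p x)
class (inside l p) zero    = inj₁ l
class (inside l p) (suc x) = class p x

emb : Part L n r → Fin r → Fin n
emb (outside p)  zero    = zero
emb (outside p)  (suc i) = suc (emb p i)
emb (inside l p) i       = suc (emb p i)

class-emb : (p : Part L n r) (i : Fin r) → class p (emb p i) ≡ inj₂ i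
class-emb (outside p)  zero    = refl
class-emb (outside p)  (suc i) = cong (map₂ suc) (class-emb p i)
class-emb (inside l p) i       = class-emb p i

emb-class : (p : Part L n r) (x : Fin n) {i : Fin r} → class p x ≡ inj₂ i → emb p i ≡ x
emb-class (outside p)  zero    refl = refl
emb-class (outside p)  (suc x) eq with class p x in eq′ | eq
... | inj₂ i | refl = cong suc (emb-class p x eq′)
emb-class (inside l p) (suc x) eq = cong suc (emb-class p x eq)

label : Part L n r → Fin n → Maybe L
label p x = isInj₁ (class p x)

isInj₁-map₂ : ∀ {A B C : Set} {f : B → C} (s : A ⊎ B) → isInj₁ (map₂ f s) ≡ isInj₁ s
isInj₁-map₂ (inj₁ _) = refl
isInj₁-map₂ (inj₂ _) = refl

fromLabels : ∀ n (f : Fin n → Maybe L) → Σ (∃ (Part L n)) λ (r , p) → ∀ x → label p x ≡ f x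
fromLabels zero    f = (0 , []) , λ ()
fromLabels (suc n) f with fromLabels n (f ∘ suc) | f zero in eq
... | (r , p) , spec | nothing = (suc r , outside p) , λ where
  zero    → sym eq
  (suc x) → trans (isInj₁-map₂ (class p x)) (spec x)
... | (r , p) , spec | just l = (r , inside l p) , λ where
  zero    → sym eq
  (suc x) → spec x

-- Nothing is lost by forgetting the indices of the outside orbits, because they are numbered in
-- order. The equality includes the number `r`, so that one match on `refl` identifies both
-- components.
label-injective : (p : Part L n r) (q : Part L n r′) → (∀ x → label p x ≡ label q x) →
                  _≡_ {A = ∃ (Part L n)} (r , p) (r′ , q)
label-injective []           []           eq = refl
label-injective (outside p)  (outside q)  eq
  with refl ← label-injective p q (λ x → trans (sym (isInj₁-map₂ (class p x))) (trans (eq (suc x)) (isInj₁-map₂ (class q x)))) = refl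
label-injective (outside p)  (inside l q) eq with () ← eq zero
label-injective (inside l p) (outside q)  eq with () ← eq zero
label-injective (inside l p) (inside m q) eq
  with refl ← eq zero | refl ← label-injective p q (eq ∘ suc) = refl

-- A place among the orbits that meet the block: `outside` only steps over an orbit, and `here`
-- needs an `inside`. Being inductive, it can be counted along with the `Part`.
data Pointer {L : Set} : Part L n r → Set where
  here    : ∀ {l} {p : Part L n r} → Pointer (inside l p)
  inside  : ∀ {l} {p : Part L n r} → Pointer p → Pointer (inside l p)
  outside : {p : Part L n r} → Pointer p → Pointer (outside p)

pos : {p : Part L n r} → Pointer p → Fin n
pos here        = zero
pos (inside u)  = suc (pos u)
pos (outside u) = suc (pos u)

pos-injective : {p : Part L n r} (u v : Pointer p) → pos u ≡ pos v → u ≡ v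
pos-injective here        here        eq = refl
pos-injective (inside u)  (inside v)  eq = cong inside (pos-injective u v (suc-injective eq))
pos-injective (outside u) (outside v) eq = cong outside (pos-injective u v (suc-injective eq))

class-pos : {p : Part L n r} (u : Pointer p) → ∃ λ l → class p (pos u) ≡ inj₁ l
class-pos here        = _ , refl
class-pos (inside u)  = class-pos u
class-pos (outside u) with l , eq ← class-pos u = l , cong (map₂ suc) eq

findPointer : (p : Part L n r) (c : Fin n → Bool) →
  (Σ (Pointer p) λ u → c (pos u) ≡ true) ⊎ (∀ x l → class p x ≡ inj₁ l → c x ≡ false)
findPointer [] c = inj₂ λ ()
findPointer (outside p) c with findPointer p (c ∘ suc)
... | inj₁ (u , cu) = inj₁ (outside u , cu)
... | inj₂ none     = inj₂ λ { (suc x) l eq → none x l (unsuc (class p x) eq) }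
  where
  unsuc : ∀ {l} (s : _ ⊎ Fin _) → map₂ suc s ≡ inj₁ l → s ≡ inj₁ l
  unsuc (inj₁ _) refl = refl
findPointer (inside l p) c with c zero in eq₀ | findPointer p (c ∘ suc)
... | true  | _             = inj₁ (here , eq₀)
... | false | inj₁ (u , cu) = inj₁ (inside u , cu)
... | false | inj₂ none     = inj₂ λ { zero _ _ → eq₀ ; (suc x) → none x }

-- The block of (0 , false) is either h-invariant (fix), and then contains both points of each
-- orbit it meets and no circle, or disjoint from its image (pair), and then contains one point
-- of each orbit it meets, at most one of them circled. The last argument codes the rest.
data Code : ℕ → Set where
  nil  : Code 0
  fix  : Part ⊤ n r → Code r → Code (suc n)
  pair : (p : Part Bool n r) → Maybe (Pointer (inside false p)) → Code r → Code (suc n)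

glue : SRel L → SRel X → SRel (L ⊎ X)
glue β ρ (inj₁ a) (inj₁ b) = β a b
glue β ρ (inj₁ _) (inj₂ _) = const false
glue β ρ (inj₂ _) (inj₁ _) = const false
glue β ρ (inj₂ x) (inj₂ y) = ρ x y

full : SRel ⊤
full _ _ _ = true

-- Here `a` and `b` are the sides on which the block meets two orbits. Two cells are related when
-- both lie in the block or both in its image, that is, when their signs differ by `a xor b`.
twist : SRel Bool
twist a b s = not ((a xor b) xor s)

-- The `Part` of a code starts after the first orbit. Prepending `inside tt` or `inside false`
-- restores it, with sign `false` because the block is the one of (0 , false).
rel : Code n → SRel (Fin n)
rel (fix p k) x y    = glue full (rel k) (class (inside tt p) x) (class (inside tt p) y)
rel (pair p _ k) x y = glue twist (rel k) (class (inside false p) x) (class (inside false p) y)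

pointsAt : {p : Part L n r} → Maybe (Pointer p) → Fin n → Bool
pointsAt nothing  x = false
pointsAt (just u) x = ⌊ pos u ≟ x ⌋

circ : Code n → Fin n → Bool
circ (fix p k) x    = [ const false , circ k ] (class (inside tt p) x)
circ (pair p c k) x = [ const (pointsAt c x) , circ k ] (class (inside false p) x)

-- Codes satisfy the conditions on arrays.

glue-equivalence : {β : SRel L} {ρ : SRel X} → IsSignedEquivalence β → IsSignedEquivalence ρ → IsSignedEquivalence (glue β ρ)
glue-equivalence β ρ .refl⁺ (inj₁ a) = β .refl⁺ a
glue-equivalence β ρ .refl⁺ (inj₂ x) = ρ .refl⁺ x
glue-equivalence β ρ .sym⁺ (inj₁ a) (inj₁ b) = β .sym⁺ a b
glue-equivalence β ρ .sym⁺ (inj₂ x) (inj₂ y) = ρ .sym⁺ x y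
glue-equivalence β ρ .trans⁺ (inj₁ a) (inj₁ b) (inj₁ c) = β .trans⁺ a b c
glue-equivalence β ρ .trans⁺ (inj₂ x) (inj₂ y) (inj₂ z) = ρ .trans⁺ x y z
glue-equivalence β ρ .trans⁺ (inj₁ a) (inj₁ b) (inj₂ z) s t _ ()
glue-equivalence β ρ .trans⁺ (inj₂ a) (inj₂ b) (inj₁ z) s t _ ()

pullback : ∀ {Y : Set} (f : Y → X) {R : SRel X} → IsSignedEquivalence R → IsSignedEquivalence (λ x y → R (f x) (f y))
pullback f e .refl⁺ x = e .refl⁺ (f x)
pullback f e .sym⁺ x y = e .sym⁺ (f x) (f y)
pullback f e .trans⁺ x y z = e .trans⁺ (f x) (f y) (f z)

full-equivalence : IsSignedEquivalence full
full-equivalence .refl⁺ _ = refl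
full-equivalence .sym⁺ _ _ _ _ = refl
full-equivalence .trans⁺ _ _ _ _ _ _ _ = refl

twist⇒≡ : ∀ a b s → twist a b s ≡ true → s ≡ a xor b
twist⇒≡ false false false _ = refl
twist⇒≡ false true  true  _ = refl
twist⇒≡ true  false true  _ = refl
twist⇒≡ true  true  false _ = refl

twist-xor : ∀ a b → twist a b (a xor b) ≡ true
twist-xor a b = cong not (xor-same (a xor b))

twist-equivalence : IsSignedEquivalence twist
twist-equivalence .refl⁺ a = cong (λ b → not (b xor false)) (xor-same a)
twist-equivalence .sym⁺ a b s = subst (λ c → not (c xor s) ≡ true) (xor-comm a b)
twist-equivalence .trans⁺ a b c s t p q with refl ← twist⇒≡ a b s p | refl ← twist⇒≡ b c t q =
  subst (λ u → twist a c u ≡ true) (sym (xor-telescope a b c)) (twist-xor a c)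

rel-equivalence : (k : Code n) → IsSignedEquivalence (rel k)
rel-equivalence nil = record { refl⁺ = λ () ; sym⁺ = λ () ; trans⁺ = λ () }
rel-equivalence (fix p k) = pullback (class (inside tt p)) (glue-equivalence full-equivalence (rel-equivalence k))
rel-equivalence (pair p c k) = pullback (class (inside false p)) (glue-equivalence twist-equivalence (rel-equivalence k))

pointsAt-unique : {p : Part L n r} (c : Maybe (Pointer p)) (x y : Fin n) → pointsAt c x ≡ true → pointsAt c y ≡ true → x ≡ y
pointsAt-unique (just u) x y px py with pos u ≟ x | pos u ≟ y
... | yes refl | yes refl = refl
... | no _     | _        = contradiction px λ ()
... | yes _    | no _     = contradiction py λ ()

-- In a mirror pair at most one orbit is circled, and its two cells lie in different blocks:
-- `twist a a s` forces `s` to be `false`.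
circ-atMostOne : (k : Code n) → AtMostOneCircle (rel k) (circ k)
circ-atMostOne (fix p k) x y s xy cx cy with class (inside tt p) x in eqx | class (inside tt p) y in eqy
... | inj₂ i | inj₂ j with refl , s≡ ← circ-atMostOne k i j s xy cx cy =
  trans (sym (emb-class (inside tt p) x eqx)) (emb-class (inside tt p) y eqy) , s≡
circ-atMostOne (pair p c k) x y s xy cx cy with class (inside false p) x in eqx | class (inside false p) y in eqy
... | inj₂ i | inj₂ j with refl , s≡ ← circ-atMostOne k i j s xy cx cy =
  trans (sym (emb-class (inside false p) x eqx)) (emb-class (inside false p) y eqy) , s≡
... | inj₁ a | inj₁ b with refl ← pointsAt-unique c x y cx cy with refl ← trans (sym eqx) eqy =
  refl , trans (twist⇒≡ a a s xy) (xor-same a)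

-- A code is determined by its array.

fixLabel : SRel (Fin (suc n)) → Fin n → Maybe ⊤
fixLabel R x = if R zero (suc x) false then just tt else nothing

-- For a block disjoint from its image at most one of the two tests succeeds, since two successes
-- would link (0 , false) to (0 , true).
pairLabel : SRel (Fin (suc n)) → Fin n → Maybe Bool
pairLabel R x = if R zero (suc x) false then just false else if R zero (suc x) true then just true else nothing

fixLabel-rel : (p : Part ⊤ n r) (k : Code r) (x : Fin n) → fixLabel (rel (fix p k)) x ≡ label p x
fixLabel-rel p k x with class p x
... | inj₁ tt = refl
... | inj₂ _  = refl

pairLabel-rel : (p : Part Bool n r) (c : _) (k : Code r) (x : Fin n) → pairLabel (rel (pair p c k)) x ≡ label p x
pairLabel-rel p c k x with class p x
... | inj₁ false = refl
... | inj₁ true  = refl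
... | inj₂ _     = refl

fixLabel-cong : {R S : SRel (Fin (suc n))} → (∀ x y s → R x y s ≡ S x y s) → ∀ x → fixLabel R x ≡ fixLabel S x
fixLabel-cong eq x rewrite eq zero (suc x) false = refl

pairLabel-cong : {R S : SRel (Fin (suc n))} → (∀ x y s → R x y s ≡ S x y s) → ∀ x → pairLabel R x ≡ pairLabel S x
pairLabel-cong eq x rewrite eq zero (suc x) false | eq zero (suc x) true = refl

fix-rel-emb : (p : Part ⊤ n r) (k : Code r) → ∀ i j s → rel (fix p k) (suc (emb p i)) (suc (emb p j)) s ≡ rel k i j s
fix-rel-emb p k i j s rewrite class-emb p i | class-emb p j = refl

fix-circ-emb : (p : Part ⊤ n r) (k : Code r) → ∀ i → circ (fix p k) (suc (emb p i)) ≡ circ k i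
fix-circ-emb p k i rewrite class-emb p i = refl

pair-rel-emb : (p : Part Bool n r) (c : _) (k : Code r) → ∀ i j s → rel (pair p c k) (suc (emb p i)) (suc (emb p j)) s ≡ rel k i j s
pair-rel-emb p c k i j s rewrite class-emb p i | class-emb p j = refl

pair-circ-emb : (p : Part Bool n r) (c : _) (k : Code r) → ∀ i → circ (pair p c k) (suc (emb p i)) ≡ circ k i
pair-circ-emb p c k i rewrite class-emb p i = refl

pair-circ-pos : (p : Part Bool n r) (c : _) (k : Code r) (u : Pointer (inside false p)) → circ (pair p c k) (pos u) ≡ pointsAt c (pos u)
pair-circ-pos p c k u with l , eq ← class-pos u rewrite eq = refl

pointsAt-pos : {p : Part L n r} (u : Pointer p) → pointsAt (just u) (pos u) ≡ true
pointsAt-pos u with pos u ≟ pos u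
... | yes _ = refl
... | no ¬p = contradiction refl ¬p

-- Agreement is asked only at pointer positions, because elsewhere `circ` reads the tail of the
-- code.
pointsAt-injective : {p : Part L n r} (c d : Maybe (Pointer p)) → (∀ (u : Pointer p) → pointsAt c (pos u) ≡ pointsAt d (pos u)) → c ≡ d
pointsAt-injective nothing  nothing  eq = refl
pointsAt-injective nothing  (just v) eq with () ← trans (eq v) (pointsAt-pos v)
pointsAt-injective (just u) nothing  eq with () ← trans (sym (eq u)) (pointsAt-pos u)
pointsAt-injective (just u) (just v) eq =
  cong just (pos-injective u v (pointsAt-unique (just v) (pos u) (pos v) (trans (sym (eq u)) (pointsAt-pos u)) (pointsAt-pos v)))

-- The entry at `zero zero true` tells `fix` from `pair`, the row of `zero` gives the labels and
-- hence the `Part`, the circles on the block give the pointer, and restriction along `emb` gives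
-- the tail.
decode-injective : (k l : Code n) → (∀ x y s → rel k x y s ≡ rel l x y s) → (∀ x → circ k x ≡ circ l x) → k ≡ l
decode-injective nil nil _ _ = refl
decode-injective (fix p k) (fix q l) req ceq
  with refl ← label-injective p q (λ x → trans (sym (fixLabel-rel p k x)) (trans (fixLabel-cong req x) (fixLabel-rel q l x))) =
  cong (fix p) (decode-injective k l
    (λ i j s → trans (sym (fix-rel-emb p k i j s)) (trans (req (suc (emb p i)) (suc (emb p j)) s) (fix-rel-emb p l i j s)))
    (λ i → trans (sym (fix-circ-emb p k i)) (trans (ceq (suc (emb p i))) (fix-circ-emb p l i))))
decode-injective (fix p k) (pair q d l) req _ with () ← req zero zero true
decode-injective (pair p c k) (fix q l) req _ with () ← req zero zero true
decode-injective (pair p c k) (pair q d l) req ceq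
  with refl ← label-injective p q (λ x → trans (sym (pairLabel-rel p c k x)) (trans (pairLabel-cong req x) (pairLabel-rel q d l x))) =
  cong₂ (pair p)
    (pointsAt-injective c d λ u → trans (sym (pair-circ-pos p c k u)) (trans (ceq (pos u)) (pair-circ-pos p d l u)))
    (decode-injective k l
      (λ i j s → trans (sym (pair-rel-emb p c k i j s)) (trans (req (suc (emb p i)) (suc (emb p j)) s) (pair-rel-emb p d l i j s)))
      (λ i → trans (sym (pair-circ-emb p c k i)) (trans (ceq (suc (emb p i))) (pair-circ-emb p d l i))))

-- Every array has a code.

Part-≤ : Part L n r → r ℕ.≤ n
Part-≤ []           = z≤n
Part-≤ (outside p)  = s≤s (Part-≤ p)
Part-≤ (inside _ p) = ℕ.m≤n⇒m≤1+n (Part-≤ p)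

≢true⇒≡false : ∀ {b} → ¬ (b ≡ true) → b ≡ false
≢true⇒≡false = ¬-not

module _ {R : SRel X} (e : IsSignedEquivalence R) where

  through : ∀ o x y s t → R o x s ≡ true → R o y t ≡ true → R x y (s xor t) ≡ true
  through o x y s t ox oy = e .trans⁺ x o y s t (e .sym⁺ o x s ox) oy

  unrelated : ∀ o x y s → R o x s ≡ true → (∀ t → R o y t ≡ false) → ∀ t → R x y t ≡ false
  unrelated o x y s ox oy t = ≢true⇒≡false λ xy → contradiction (trans (sym (e .trans⁺ o x y s t ox xy)) (oy (s xor t))) λ ()

  sym-≡ : ∀ x y s → R x y s ≡ R y x s
  sym-≡ x y s with R x y s in xy | R y x s in yx
  ... | true  | true  = refl
  ... | false | false = refl
  ... | true  | false = trans (sym (e .sym⁺ x y s xy)) yx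
  ... | false | true  = trans (sym xy) (e .sym⁺ y x s yx)

-- Only the block and the rest have to be compared: transitivity through `o` keeps a point of the
-- block apart from an orbit that misses it, for both signs. The argument `sign` names one point of
-- the block on each orbit that it meets.
glue-unique : (q : Part L n r) {R : SRel (Fin n)} (e : IsSignedEquivalence R) (o : Fin n) (sign : L → Bool) {β : SRel L} {ρ : SRel (Fin r)} →
  (∀ x a → class q x ≡ inj₁ a → R o x (sign a) ≡ true) →
  (∀ x i → class q x ≡ inj₂ i → ∀ s → R o x s ≡ false) →
  (∀ x y a b → class q x ≡ inj₁ a → class q y ≡ inj₁ b → ∀ s → β a b s ≡ R x y s) →
  (∀ i j s → ρ i j s ≡ R (emb q i) (emb q j) s) →
  ∀ x y s → glue β ρ (class q x) (class q y) s ≡ R x y s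
glue-unique q {R} e o sign inB outB β≡ ρ≡ x y s with class q x in eqx | class q y in eqy
... | inj₁ a | inj₁ b = β≡ x y a b eqx eqy s
... | inj₁ a | inj₂ j = sym (unrelated e o x y (sign a) (inB x a eqx) (outB y j eqy) s)
... | inj₂ i | inj₁ b = sym (trans (sym-≡ e x y s) (unrelated e o y x (sign b) (inB y b eqy) (outB x i eqx) s))
... | inj₂ i | inj₂ j = trans (ρ≡ i j s) (cong₂ (λ u v → R u v s) (emb-class q x eqx) (emb-class q y eqy))

emb-injective : (p : Part L n r) {i j : Fin r} → emb p i ≡ emb p j → i ≡ j
emb-injective p {i} {j} eq with refl ← trans (sym (class-emb p i)) (trans (cong (class p) eq) (class-emb p j)) = refl

atMostOne-emb : (p : Part L n r) {R : SRel (Fin n)} {c : Fin n → Bool} → AtMostOneCircle R c →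
                AtMostOneCircle (λ i j → R (emb p i) (emb p j)) (c ∘ emb p)
atMostOne-emb p one i j s ij ci cj with eq , s≡ ← one _ _ s ij ci cj = emb-injective p eq , s≡

-- This is the total sign of a walk from orbit 0 to the first orbit, on to the second, and back. The
-- value `true` would link (0 , false) to its mirror image.
twist≡false : ∀ a b s → twist a b s ≡ false → (a xor s) xor b ≡ true
twist≡false false false true  _ = refl
twist≡false false true  false _ = refl
twist≡false true  false false _ = refl
twist≡false true  true  true  _ = refl

Decoding : (R : SRel (Fin n)) (c : Fin n → Bool) → Set
Decoding {n} R c = Σ (Code n) λ k → (∀ x y s → rel k x y s ≡ R x y s) × (∀ x → circ k x ≡ c x)

DecodableUpTo : ℕ → Set
DecodableUpTo n = ∀ {r} → r ℕ.≤ n → (R : SRel (Fin r)) (c : Fin r → Bool) → IsSignedEquivalence R → AtMostOneCircle R c → Decoding R c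

module _ (rec : DecodableUpTo n) (R : SRel (Fin (suc n))) (c : Fin (suc n) → Bool) (e : IsSignedEquivalence R) (one : AtMostOneCircle R c) where

  decode-fix : R zero zero true ≡ true → Decoding R c
  decode-fix 00⁻ with fromLabels n (fixLabel R)
  ... | (r , p) , spec = fix p k , glue-unique q e zero (const false) in⁺ outB β≡ rel≡ , circ≡
    where
    q = inside tt p

    decoding = rec (Part-≤ p) (λ i j → R (emb q i) (emb q j)) (c ∘ emb q) (pullback (emb q) e) (atMostOne-emb q one)
    k = proj₁ decoding
    rel≡ = proj₁ (proj₂ decoding)

    in⁺ : ∀ x a → class q x ≡ inj₁ a → R zero x false ≡ true
    in⁺ zero    a _  = e .refl⁺ zero
    in⁺ (suc x) a eq with R zero (suc x) false | trans (sym (cong isInj₁ eq)) (spec x)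
    ... | true | _ = refl

    inB : ∀ x a → class q x ≡ inj₁ a → ∀ s → R zero x s ≡ true
    inB x a eq false = in⁺ x a eq
    -- The block contains (0 , true), so it contains the reflection of each of its points.
    inB x a eq true  = e .trans⁺ zero zero x true false 00⁻ (in⁺ x a eq)

    out⁺ : ∀ x i → class q x ≡ inj₂ i → R zero x false ≡ false
    out⁺ (suc x) i eq with R zero (suc x) false | trans (sym (cong isInj₁ eq)) (spec x)
    ... | false | _ = refl

    outB : ∀ x i → class q x ≡ inj₂ i → ∀ s → R zero x s ≡ false
    outB x i eq false = out⁺ x i eq
    outB x i eq true  = ≢true⇒≡false λ 0x →
      contradiction (trans (sym (e .trans⁺ zero zero x true true 00⁻ 0x)) (out⁺ x i eq)) λ ()

    β≡ : ∀ x y a b → class q x ≡ inj₁ a → class q y ≡ inj₁ b → ∀ s → true ≡ R x y s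
    β≡ x y a b eqx eqy s = sym (through e zero x y false s (inB x a eqx false) (inB y b eqy s))

    circ≡ : ∀ x → circ (fix p k) x ≡ c x
    circ≡ x with class q x in eq
    -- An invariant block relates `x` to itself with sign `true`; a circle there would make `one`
    -- yield `true ≡ false`.
    ... | inj₁ a = sym (≢true⇒≡false λ cx → contradiction (proj₂ (one x x true (sym (β≡ x x a a eq eq true)) cx cx)) λ ())
    ... | inj₂ i = trans (proj₂ (proj₂ decoding) i) (cong c (emb-class q x eq))

  decode-pair : R zero zero true ≡ false → Decoding R c
  decode-pair 00⁻ with fromLabels n (pairLabel R)
  ... | (r , p) , spec = pair p circle k , glue-unique q e zero id inB outB β≡ rel≡ , circ≡
    where
    q = inside false p

    decoding = rec (Part-≤ p) (λ i j → R (emb q i) (emb q j)) (c ∘ emb q) (pullback (emb q) e) (atMostOne-emb q one)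
    k = proj₁ decoding
    rel≡ = proj₁ (proj₂ decoding)

    inB : ∀ x a → class q x ≡ inj₁ a → R zero x a ≡ true
    inB zero    false _  = e .refl⁺ zero
    inB (suc x) a     eq
      with R zero (suc x) false in 0x⁺ | R zero (suc x) true in 0x⁻ | trans (sym (cong isInj₁ eq)) (spec x)
    ... | true  | _    | refl = 0x⁺
    ... | false | true | refl = 0x⁻

    outB : ∀ x i → class q x ≡ inj₂ i → ∀ s → R zero x s ≡ false
    outB (suc x) i eq s
      with R zero (suc x) false in 0x⁺ | R zero (suc x) true in 0x⁻ | trans (sym (cong isInj₁ eq)) (spec x) | s
    ... | false | false | _ | false = 0x⁺
    ... | false | false | _ | true  = 0x⁻

    β≡ : ∀ x y a b → class q x ≡ inj₁ a → class q y ≡ inj₁ b → ∀ s → twist a b s ≡ R x y s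
    β≡ x y a b eqx eqy s with twist a b s in tw
    ... | true with refl ← twist⇒≡ a b s tw = sym (through e zero x y a b (inB x a eqx) (inB y b eqy))
    -- A sign other than `a xor b` closes the walk from `zero` over `x` and `y` with sign `true`,
    -- against `00⁻`.
    ... | false = sym (≢true⇒≡false λ xy → contradiction
      (trans (sym 00⁻) (subst (λ t → R zero zero t ≡ true) (twist≡false a b s tw)
        (e .trans⁺ zero y zero (a xor s) b (e .trans⁺ zero x y a s (inB x a eqx) xy) (e .sym⁺ zero y b (inB y b eqy))))) λ ())

    findCircle : Σ (Maybe (Pointer q)) λ u → ∀ x a → class q x ≡ inj₁ a → pointsAt u x ≡ c x
    findCircle with findPointer q c
    ... | inj₂ none     = nothing , λ x a eq → sym (none x a eq)
    ... | inj₁ (u , cu) = just u , only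
      where
      only : ∀ x a → class q x ≡ inj₁ a → ⌊ pos u ≟ x ⌋ ≡ c x
      only x a eq with pos u ≟ x
      ... | yes refl = sym cu
      ... | no ≢x with b , equ ← class-pos u = sym (≢true⇒≡false λ cx → ≢x (proj₁ (one (pos u) x (b xor a)
            (through e zero (pos u) x b a (inB (pos u) b equ) (inB x a eq)) cu cx)))

    circle = proj₁ findCircle

    circ≡ : ∀ x → circ (pair p circle k) x ≡ c x
    circ≡ x with class q x in eq
    ... | inj₁ a = proj₂ findCircle x a eq
    ... | inj₂ i = trans (proj₂ (proj₂ decoding) i) (cong c (emb-class q x eq))

-- The induction is on a bound `m`, because the tail lives on a number of orbits that `fromLabels`
-- produces and that is only known to be at most `n`.
decode-surjective : ∀ m {n} → n ℕ.≤ m → (R : SRel (Fin n)) (c : Fin n → Bool) → IsSignedEquivalence R → AtMostOneCircle R c → Decoding R c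
decode-surjective m       {zero}  _         R c e one = nil , (λ ()) , λ ()
decode-surjective (suc m) {suc n} (s≤s n≤m) R c e one with R zero zero true in 00⁻
... | true  = decode-fix (λ r≤n → decode-surjective m (ℕ.≤-trans r≤n n≤m)) R c e one 00⁻
... | false = decode-pair (λ r≤n → decode-surjective m (ℕ.≤-trans r≤n n≤m)) R c e one 00⁻

-- Counting the codes

Parted : Set → (ℕ → Set) → ℕ → Set
Parted L K n = ∃ λ r → Part L n r × K r

Pointed : (ℕ → Set) → ℕ → Set
Pointed K n = ∃ λ r → Σ (Part Bool n r) λ p → Pointer p × K r

Fin-+ : ∀ {A B : Set} {a b} → A ↔ Fin a → B ↔ Fin b → (A ⊎ B) ↔ Fin (a ℕ.+ b)
Fin-+ f g = ↔-trans (f ⊎-↔ g) (↔-sym +↔⊎)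

Fin-* : ∀ {A B : Set} {a b} → A ↔ Fin a → B ↔ Fin b → (A × B) ↔ Fin (a ℕ.* b)
Fin-* f g = ↔-trans (f ×-↔ g) (↔-sym *↔×)

Parted-suc : ∀ {K : ℕ → Set} → Parted L K (suc n) ↔ ((L × Parted L K n) ⊎ Parted L (K ∘ suc) n)
Parted-suc = mk↔ₛ′
  (λ { (r , inside l p , k) → inj₁ (l , r , p , k) ; (suc r , outside p , k) → inj₂ (r , p , k) })
  (λ { (inj₁ (l , r , p , k)) → r , inside l p , k ; (inj₂ (r , p , k)) → suc r , outside p , k })
  (λ { (inj₁ _) → refl ; (inj₂ _) → refl })
  (λ { (r , inside l p , k) → refl ; (suc r , outside p , k) → refl })

Pointed-suc : ∀ {K : ℕ → Set} → Pointed K (suc n) ↔ ((Bool × (Parted Bool K n ⊎ Pointed K n)) ⊎ Pointed (K ∘ suc) n)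
Pointed-suc = mk↔ₛ′
  (λ { (r , inside l p , here , k)         → inj₁ (l , inj₁ (r , p , k))
     ; (r , inside l p , inside u , k)     → inj₁ (l , inj₂ (r , p , u , k))
     ; (suc r , outside p , outside u , k) → inj₂ (r , p , u , k) })
  (λ { (inj₁ (l , inj₁ (r , p , k)))     → r , inside l p , here , k
     ; (inj₁ (l , inj₂ (r , p , u , k))) → r , inside l p , inside u , k
     ; (inj₂ (r , p , u , k))            → suc r , outside p , outside u , k })
  (λ { (inj₁ (_ , inj₁ _)) → refl ; (inj₁ (_ , inj₂ _)) → refl ; (inj₂ _) → refl })
  (λ { (r , inside l p , here , k) → refl ; (r , inside l p , inside u , k) → refl
     ; (suc r , outside p , outside u , k) → refl })

-- The family `K` is arbitrary because an outside orbit goes on to the rest, replacing `K` and `g`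
-- by `K ∘ suc` and `g ∘ suc`.
Parted-↔ : ∀ {w} → L ↔ Fin w → ∀ n {K : ℕ → Set} {g : ℕ → ℕ} → (∀ r → r ℕ.≤ n → K r ↔ Fin (g r)) → Parted L K n ↔ Fin (partCount w n g)
Parted-↔ L↔ zero {K} K↔ = ↔-trans
  (mk↔ₛ′ (λ { (_ , [] , k) → k }) (λ k → 0 , [] , k) (λ _ → refl) (λ { (_ , [] , k) → refl }))
  (K↔ 0 z≤n)
Parted-↔ L↔ (suc n) K↔ = ↔-trans Parted-suc
  (Fin-+ (Fin-* L↔ (Parted-↔ L↔ n (λ r r≤n → K↔ r (ℕ.m≤n⇒m≤1+n r≤n))))
         (Parted-↔ L↔ n (λ r r≤n → K↔ (suc r) (s≤s r≤n))))

Pointed-↔ : ∀ n {K : ℕ → Set} {g : ℕ → ℕ} → (∀ r → r ℕ.≤ n → K r ↔ Fin (g r)) → Pointed K n ↔ Fin (pointedCount n g)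
Pointed-↔ zero K↔ = mk↔ₛ′ (λ { (_ , [] , () , _) }) (λ ()) (λ ()) (λ { (_ , [] , () , _) })
Pointed-↔ (suc n) K↔ = ↔-trans Pointed-suc
  (Fin-+ (Fin-* (↔-sym 2↔Bool) (Fin-+ (Parted-↔ (↔-sym 2↔Bool) n K↔′) (Pointed-↔ n K↔′)))
         (Pointed-↔ n (λ r r≤n → K↔ (suc r) (s≤s r≤n))))
  where K↔′ = λ r r≤n → K↔ r (ℕ.m≤n⇒m≤1+n r≤n)

-- A pair splits by its circle: none, on the first orbit, or on a later one. These are the two
-- summands e^{2z} and the summand 2z e^{2z}.
Code-suc : Code (suc n) ↔ (Parted ⊤ Code n ⊎ (Parted Bool Code n ⊎ (Parted Bool Code n ⊎ Pointed Code n)))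
Code-suc = mk↔ₛ′
  (λ { (fix p k)                   → inj₁ (_ , p , k)
     ; (pair p nothing k)          → inj₂ (inj₁ (_ , p , k))
     ; (pair p (just here) k)      → inj₂ (inj₂ (inj₁ (_ , p , k)))
     ; (pair p (just (inside u)) k) → inj₂ (inj₂ (inj₂ (_ , p , u , k))) })
  (λ { (inj₁ (_ , p , k))                      → fix p k
     ; (inj₂ (inj₁ (_ , p , k)))               → pair p nothing k
     ; (inj₂ (inj₂ (inj₁ (_ , p , k))))        → pair p (just here) k
     ; (inj₂ (inj₂ (inj₂ (_ , p , u , k))))    → pair p (just (inside u)) k })
  (λ { (inj₁ _) → refl ; (inj₂ (inj₁ _)) → refl ; (inj₂ (inj₂ (inj₁ _))) → refl ; (inj₂ (inj₂ (inj₂ _))) → refl })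
  (λ { (fix p k) → refl ; (pair p nothing k) → refl ; (pair p (just here) k) → refl ; (pair p (just (inside u)) k) → refl })

Code-↔ : ∀ k n → n ℕ.< k → Code n ↔ Fin (codeCount k n)
Code-↔ (suc k) zero    _         = mk↔ₛ′ (λ _ → zero) (λ _ → nil) (λ { zero → refl }) (λ { nil → refl })
Code-↔ (suc k) (suc n) (s≤s n<k) = ↔-trans Code-suc
  (Fin-+ (Parted-↔ (↔-sym 1↔⊤) n ih) (Fin-+ pairs (Fin-+ pairs (Pointed-↔ n ih))))
  where
  ih : ∀ r → r ℕ.≤ n → Code r ↔ Fin (codeCount k r)
  ih r r≤n = Code-↔ k r (ℕ.≤-<-trans r≤n n<k)
  pairs = Parted-↔ (↔-sym 2↔Bool) n ih

-- From codes to tables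

-- Two lists without repetitions and with the same members are permutations of each other, so the
-- filtered list is as long as the tabulation of `f`.
length-filter-via : ∀ {P : A → Set} (P? : Decidable P) {xs : List A} {N} (f : Fin N → A) →
  Unique xs → (∀ x → x ∈ xs) →
  (∀ {i j} → f i ≡ f j → i ≡ j) → (∀ i → P (f i)) → (∀ x → P x → ∃ λ i → x ≡ f i) →
  length (filter P? xs) ≡ N
length-filter-via P? {xs} {N} f uniq complete inj sound surj = trans
  (↭-length (∼bag⇒↭ (unique∧set⇒bag (filter⁺ P? uniq) (tabulate⁺ inj) (mk⇔ to from))))
  (length-tabulate f)
  where
  to : ∀ {x} → x ∈ filter P? xs → x ∈ tabulate f
  to x∈ with i , refl ← surj _ (proj₂ (∈-filter⁻ P? {xs = xs} x∈)) = ∈-tabulate⁺ i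
  from : ∀ {x} → x ∈ tabulate f → x ∈ filter P? xs
  from x∈ with i , refl ← ∈-tabulate⁻ x∈ = ∈-filter⁺ P? (complete (f i)) (sound i)

concatMap-map : ∀ {A B C : Set} (f : A → B → C) xs ys → concatMap (λ x → map (f x) ys) xs ≡ cartesianProductWith f xs ys
concatMap-map f []       ys = refl
concatMap-map f (x ∷ xs) ys = cong (map (f x) ys ++_) (concatMap-map f xs ys)

allVecs-unique : {xs : List A} → Unique xs → ∀ k → Unique (allVecs xs k)
allVecs-unique u zero = [] ∷ []
allVecs-unique {xs = xs} u (suc k) rewrite concatMap-map Vec._∷_ xs (allVecs xs k) =
  cartesianProductWith⁺ Vec._∷_ ∷-injective u (allVecs-unique u k)

∈-allVecs : {xs : List A} → (∀ x → x ∈ xs) → ∀ k v → v ∈ allVecs xs k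
∈-allVecs c zero    []      = here refl
∈-allVecs {xs = xs} c (suc k) (x ∷ v) rewrite concatMap-map Vec._∷_ xs (allVecs xs k) =
  ∈-cartesianProductWith⁺ Vec._∷_ (c x) (∈-allVecs c k v)

allBools-unique : Unique allBools
allBools-unique = ((λ ()) ∷ []) ∷ [] ∷ []

∈-allBools : ∀ b → b ∈ allBools
∈-allBools false = here refl
∈-allBools true  = there (here refl)

allCandidates-unique : ∀ a b → Unique (allCandidates a b)
allCandidates-unique a b = cartesianProduct⁺
  (allVecs-unique (allVecs-unique allBools-unique (a ℕ.* b)) (a ℕ.* b))
  (allVecs-unique allBools-unique (a ℕ.* b))

∈-allCandidates : ∀ a b p → p ∈ allCandidates a b
∈-allCandidates a b (π , C) = ∈-cartesianProduct⁺
  (∈-allVecs (∈-allVecs ∈-allBools (a ℕ.* b)) (a ℕ.* b) π)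
  (∈-allVecs ∈-allBools (a ℕ.* b) C)

lookup-injective : ∀ {xs ys : Vec A n} → (∀ i → lookup xs i ≡ lookup ys i) → xs ≡ ys
lookup-injective {xs = xs} {ys} eq = trans (sym (tabulate∘lookup xs)) (trans (tabulate-cong eq) (tabulate∘lookup ys))

module _ {a b : ℕ} where

  cell : Fin (a ℕ.* b) → Cell a b
  cell = remQuot b

  relTable : (Cell a b → Cell a b → Bool) → BRel a b
  relTable f = Vec.tabulate λ p → Vec.tabulate λ q → f (cell p) (cell q)

  setTable : (Cell a b → Bool) → CSet a b
  setTable f = Vec.tabulate (f ∘ cell)

  sameBlock-relTable : ∀ f x y → sameBlock {a} {b} (relTable f) x y ≡ f x y
  sameBlock-relTable f x@(i , j) y@(i′ , j′) = begin
    lookup (lookup (relTable f) (idx x)) (idx y) ≡⟨ cong (λ v → lookup v (idx y)) (lookup∘tabulate _ (idx x)) ⟩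
    lookup (Vec.tabulate (λ q → f (cell (idx x)) (cell q))) (idx y) ≡⟨ lookup∘tabulate _ (idx y) ⟩
    f (cell (idx x)) (cell (idx y)) ≡⟨ cong₂ f (remQuot-combine i j) (remQuot-combine i′ j′) ⟩
    f x y ∎
    where open ≡-Reasoning

  circled-setTable : ∀ f x → circled {a} {b} (setTable f) x ≡ f x
  circled-setTable f x@(i , j) = trans (lookup∘tabulate _ (idx x)) (cong f (remQuot-combine i j))

  sameBlock-injective : ∀ {π ρ : BRel a b} → (∀ x y → sameBlock π x y ≡ sameBlock ρ x y) → π ≡ ρ
  sameBlock-injective {π} {ρ} eq = lookup-injective λ p → lookup-injective λ q →
    subst₂ (λ u v → lookup (lookup π u) v ≡ lookup (lookup ρ u) v) (combine-remQuot {a} b p) (combine-remQuot {a} b q) (eq (cell p) (cell q))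

  circled-injective : ∀ {C E : CSet a b} → (∀ x → circled C x ≡ circled E x) → C ≡ E
  circled-injective {C} {E} eq = lookup-injective λ p →
    subst (λ u → lookup C u ≡ lookup E u) (combine-remQuot {a} b p) (eq (cell p))

-- Arrays in orbit coordinates.

xor≡false : ∀ s t → s xor t ≡ false → s ≡ t
xor≡false false false _ = refl
xor≡false true  true  _ = refl

-- All that the count uses of the grid: by `sign-h` the reflection has no fixed cell, and each of
-- the `N` orbits consists of two cells.
record OrbitCoordinates (a b N : ℕ) : Set where
  field
    orbit : Cell a b → Fin N
    sign  : Cell a b → Bool
    point : Fin N → Bool → Cell a b
    point-orbit : ∀ x → point (orbit x) (sign x) ≡ x
    orbit-point : ∀ ω s → orbit (point ω s) ≡ ω
    sign-point  : ∀ ω s → sign (point ω s) ≡ s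
    orbit-h : ∀ x → orbit (h x) ≡ orbit x
    sign-h  : ∀ x → sign (h x) ≡ not (sign x)

module _ {a b N : ℕ} (coords : OrbitCoordinates a b N) where
  open OrbitCoordinates coords

  liftRel : SRel (Fin N) → Cell a b → Cell a b → Bool
  liftRel R x y = R (orbit x) (orbit y) (sign x xor sign y)

  encode : Code N → BRel a b × CSet a b
  encode k = relTable (liftRel (rel k)) , setTable (circ k ∘ orbit)

  sameBlock-encode : ∀ k x y → sameBlock {a} {b} (proj₁ (encode k)) x y ≡ liftRel (rel k) x y
  sameBlock-encode k = sameBlock-relTable (liftRel (rel k))

  circled-encode : ∀ k x → circled {a} {b} (proj₂ (encode k)) x ≡ circ k (orbit x)
  circled-encode k = circled-setTable (circ k ∘ orbit)

  point-injective : ∀ x y → orbit x ≡ orbit y → sign x ≡ sign y → x ≡ y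
  point-injective x y o s = trans (sym (point-orbit x)) (trans (cong₂ point o s) (point-orbit y))

  liftRel-point : ∀ R ω ω′ s → liftRel R (point ω false) (point ω′ s) ≡ R ω ω′ s
  liftRel-point R ω ω′ s rewrite orbit-point ω false | orbit-point ω′ s | sign-point ω false | sign-point ω′ s = refl

  encode-injective : ∀ {k l} → encode k ≡ encode l → k ≡ l
  encode-injective {k} {l} eq = decode-injective k l
    (λ ω ω′ s → begin
      rel k ω ω′ s                                    ≡⟨ liftRel-point (rel k) ω ω′ s ⟨
      liftRel (rel k) (point ω false) (point ω′ s)    ≡⟨ sameBlock-encode k _ _ ⟨
      sameBlock {a} {b} (proj₁ (encode k)) (point ω false) (point ω′ s) ≡⟨ cong (λ e → sameBlock {a} {b} (proj₁ e) (point ω false) (point ω′ s)) eq ⟩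
      sameBlock {a} {b} (proj₁ (encode l)) (point ω false) (point ω′ s) ≡⟨ sameBlock-encode l _ _ ⟩
      liftRel (rel l) (point ω false) (point ω′ s)    ≡⟨ liftRel-point (rel l) ω ω′ s ⟩
      rel l ω ω′ s                                    ∎)
    (λ ω → begin
      circ k ω                                          ≡⟨ cong (circ k) (orbit-point ω false) ⟨
      circ k (orbit (point ω false))                    ≡⟨ circled-encode k _ ⟨
      circled {a} {b} (proj₂ (encode k)) (point ω false) ≡⟨ cong (λ e → circled {a} {b} (proj₂ e) (point ω false)) eq ⟩
      circled {a} {b} (proj₂ (encode l)) (point ω false) ≡⟨ circled-encode l _ ⟩
      circ l (orbit (point ω false))                    ≡⟨ cong (circ l) (orbit-point ω false) ⟩
      circ l ω                                          ∎)
    where open ≡-Reasoning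

  open IsSignedEquivalence

  encode-fixed : ∀ k → IsFixedArray {a} {b} (encode k)
  encode-fixed k = ((reflexive , symmetric , transitive) , atMostOne) , relFixed , circFixed
    where
    R = rel k
    e = rel-equivalence k
    π = proj₁ (encode k)
    C = proj₂ (encode k)
    same = sameBlock-encode k
    circ≡ = circled-encode k

    reflexive : ∀ x → sameBlock {a} {b} π x x ≡ true
    reflexive x = trans (same x x) (trans (cong (R (orbit x) (orbit x)) (xor-same (sign x))) (e .refl⁺ (orbit x)))

    symmetric : ∀ x y → sameBlock {a} {b} π x y ≡ true → sameBlock {a} {b} π y x ≡ true
    symmetric x y xy = trans (same y x) (trans (cong (R (orbit y) (orbit x)) (xor-comm (sign y) (sign x)))
      (e .sym⁺ (orbit x) (orbit y) (sign x xor sign y) (trans (sym (same x y)) xy)))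

    transitive : ∀ x y z → sameBlock {a} {b} π x y ≡ true → sameBlock {a} {b} π y z ≡ true → sameBlock {a} {b} π x z ≡ true
    transitive x y z xy yz = trans (same x z) (trans (cong (R (orbit x) (orbit z)) (sym (xor-telescope (sign x) (sign y) (sign z))))
      (e .trans⁺ (orbit x) (orbit y) (orbit z) _ _ (trans (sym (same x y)) xy) (trans (sym (same y z)) yz)))

    atMostOne : AtMostOneCircledPerBlock {a} {b} π C
    atMostOne x y xy cx cy
      with o , s ← circ-atMostOne k (orbit x) (orbit y) (sign x xor sign y)
                     (trans (sym (same x y)) xy) (trans (sym (circ≡ x)) cx) (trans (sym (circ≡ y)) cy) =
      point-injective x y o (xor≡false (sign x) (sign y) s)

    relFixed : ∀ x y → sameBlock {a} {b} π (h x) (h y) ≡ sameBlock {a} {b} π x y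
    relFixed x y = begin
      sameBlock {a} {b} π (h x) (h y) ≡⟨ same (h x) (h y) ⟩
      R (orbit (h x)) (orbit (h y)) (sign (h x) xor sign (h y)) ≡⟨ cong₂ (λ u v → R u v (sign (h x) xor sign (h y))) (orbit-h x) (orbit-h y) ⟩
      R (orbit x) (orbit y) (sign (h x) xor sign (h y)) ≡⟨ cong₂ (λ s t → R (orbit x) (orbit y) (s xor t)) (sign-h x) (sign-h y) ⟩
      R (orbit x) (orbit y) (not (sign x) xor not (sign y)) ≡⟨ cong (R (orbit x) (orbit y)) (xor-annihilates-not (sign x) (sign y)) ⟩
      liftRel R x y ≡⟨ same x y ⟨
      sameBlock {a} {b} π x y ∎
      where open ≡-Reasoning

    circFixed : ∀ x → circled {a} {b} C (h x) ≡ circled {a} {b} C x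
    circFixed x = trans (circ≡ (h x)) (trans (cong (circ k) (orbit-h x)) (sym (circ≡ x)))

  encode-surjective : ∀ p → IsFixedArray {a} {b} p → ∃ λ k → p ≡ encode k
  encode-surjective (π , C) (((reflexive , symmetric , transitive) , atMostOne) , relFixed , circFixed) =
    k , cong₂ _,_
      (sameBlock-injective {a} {b} λ x y → trans (S-orbit x y) (trans (sym (rel≡ _ _ _)) (sym (sameBlock-encode k x y))))
      (circled-injective {a} {b} λ x → trans (c-orbit x) (trans (sym (circ≡ _)) (sym (circled-encode k x))))
    where
    S = sameBlock {a} {b} π

    h-point : ∀ x → h x ≡ point (orbit x) (not (sign x))
    h-point x = trans (sym (point-orbit (h x))) (cong₂ point (orbit-h x) (sign-h x))

    R : SRel (Fin N)
    R ω ω′ s = S (point ω false) (point ω′ s)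

    c : Fin N → Bool
    c ω = circled {a} {b} C (point ω false)

    -- When the first point has sign `true`, reflecting both points brings it to sign `false` and
    -- turns `t` into `not t`, which is `true xor t`.
    S-point : ∀ ω ω′ s t → S (point ω s) (point ω′ t) ≡ R ω ω′ (s xor t)
    S-point ω ω′ false t = refl
    S-point ω ω′ true  t = trans (sym (relFixed (point ω true) (point ω′ t)))
      (cong₂ S (trans (h-point _) (cong₂ point (orbit-point ω true) (cong not (sign-point ω true))))
               (trans (h-point _) (cong₂ point (orbit-point ω′ t) (cong not (sign-point ω′ t)))))

    c-point : ∀ ω s → circled {a} {b} C (point ω s) ≡ c ω
    c-point ω false = refl
    c-point ω true  = trans (sym (circFixed (point ω true)))
      (cong (circled {a} {b} C) (trans (h-point _) (cong₂ point (orbit-point ω true) (cong not (sign-point ω true)))))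

    S-orbit : ∀ x y → S x y ≡ liftRel R x y
    S-orbit x y = trans (cong₂ S (sym (point-orbit x)) (sym (point-orbit y))) (S-point (orbit x) (orbit y) (sign x) (sign y))

    c-orbit : ∀ x → circled {a} {b} C x ≡ c (orbit x)
    c-orbit x = trans (cong (circled {a} {b} C) (sym (point-orbit x))) (c-point (orbit x) (sign x))

    R-equivalence : IsSignedEquivalence R
    R-equivalence .refl⁺ ω = reflexive (point ω false)
    R-equivalence .sym⁺ ω ω′ s p = trans
      (sym (trans (S-point ω′ ω s false) (cong (R ω′ ω) (xor-identityʳ s))))
      (symmetric (point ω false) (point ω′ s) p)
    R-equivalence .trans⁺ ω ω′ ω″ s t p q = transitive (point ω false) (point ω′ s) (point ω″ (s xor t)) p
      -- The points over ω′ and ω″ have signs `s` and `s xor t`, whose difference is `t`.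
      (trans (S-point ω′ ω″ s (s xor t)) (trans (cong (R ω′ ω″) (xor-cancelˡ s t)) q))

    R-atMostOne : AtMostOneCircle R c
    R-atMostOne ω ω′ s p cω cω′ = trans (sym (orbit-point ω false)) (trans (cong orbit eq) (orbit-point ω′ s)) ,
                                   trans (sym (sign-point ω′ s)) (trans (cong sign (sym eq)) (sign-point ω false))
      where
      eq : point ω false ≡ point ω′ s
      eq = atMostOne (point ω false) (point ω′ s) p cω (trans (c-point ω′ s) cω′)

    decoding : Decoding R c
    decoding = decode-surjective N ℕ.≤-refl R c R-equivalence R-atMostOne

    k : Code N
    k = proj₁ decoding
    rel≡ = proj₁ (proj₂ decoding)
    circ≡ = proj₂ (proj₂ decoding)

  H≡codeCount : H a b ≡ codeCount (suc N) N
  H≡codeCount = length-filter-via (isFixedArray? a b) (encode ∘ from)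
    (allCandidates-unique a b) (∈-allCandidates a b)
    (λ {i} {j} eq → trans (sym (strictlyInverseˡ i)) (trans (cong to (encode-injective eq)) (strictlyInverseˡ j)))
    (encode-fixed ∘ from)
    (λ p fixed → let (k , eq) = encode-surjective p fixed in
      to k , trans eq (cong encode (sym (strictlyInverseʳ k))))
    where open Inverse (Code-↔ (suc N) N ℕ.≤-refl)

-- Orbit coordinates of the grid with an even number of rows.

module _ (m : ℕ) where

  m≤2m : m ℕ.≤ 2 ℕ.* m
  m≤2m = ℕ.m≤m+n m _

  2m≡m+m : 2 ℕ.* m ≡ m ℕ.+ m
  2m≡m+m = cong (m ℕ.+_) (ℕ.+-identityʳ m)

  -- The indices of a row and its mirror image add up to `2 * m - 1`, so they cannot both be below
  -- `m`; nor can both be at least `m`. There is no middle row.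
  lower⇒opposite-upper : ∀ (i : Fin (2 ℕ.* m)) → toℕ i ℕ.< m → ¬ (toℕ (opposite i) ℕ.< m)
  lower⇒opposite-upper i i<m oi<m = ℕ.<-irrefl refl (begin-strict
    2 ℕ.* m                                   ≡⟨ ℕ.m+[n∸m]≡n (toℕ<n i) ⟨
    suc (toℕ i) ℕ.+ (2 ℕ.* m ℕ.∸ suc (toℕ i)) ≡⟨ cong (suc (toℕ i) ℕ.+_) (opposite-prop i) ⟨
    suc (toℕ i) ℕ.+ toℕ (opposite i)          <⟨ ℕ.+-mono-≤-< i<m oi<m ⟩
    m ℕ.+ m                                   ≡⟨ 2m≡m+m ⟨
    2 ℕ.* m                                   ∎)
    where open ℕ.≤-Reasoning

  upper⇒opposite-lower : ∀ (i : Fin (2 ℕ.* m)) → ¬ (toℕ i ℕ.< m) → toℕ (opposite i) ℕ.< m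
  upper⇒opposite-lower i i≮m = ℕ.+-cancelˡ-≤ m _ _ (begin
    m ℕ.+ suc (toℕ (opposite i))              ≡⟨ ℕ.+-suc m _ ⟩
    suc m ℕ.+ toℕ (opposite i)                ≤⟨ ℕ.+-monoˡ-≤ _ (s≤s (ℕ.≮⇒≥ i≮m)) ⟩
    suc (toℕ i) ℕ.+ toℕ (opposite i)          ≡⟨ cong (suc (toℕ i) ℕ.+_) (opposite-prop i) ⟩
    suc (toℕ i) ℕ.+ (2 ℕ.* m ℕ.∸ suc (toℕ i)) ≡⟨ ℕ.m+[n∸m]≡n (toℕ<n i) ⟩
    2 ℕ.* m                                   ≡⟨ 2m≡m+m ⟩
    m ℕ.+ m                                   ∎)
    where open ℕ.≤-Reasoning

  fold : Fin (2 ℕ.* m) → Fin m × Bool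
  fold i with toℕ i ℕ.<? m
  ... | yes i<m = fromℕ< i<m , false
  ... | no  i≮m = fromℕ< (upper⇒opposite-lower i i≮m) , true

  unfold : Fin m → Bool → Fin (2 ℕ.* m)
  unfold i false = inject≤ i m≤2m
  unfold i true  = opposite (inject≤ i m≤2m)

  inject≤-fromℕ< : ∀ {i : Fin (2 ℕ.* m)} (i<m : toℕ i ℕ.< m) → inject≤ (fromℕ< i<m) m≤2m ≡ i
  inject≤-fromℕ< i<m = toℕ-injective (trans (toℕ-inject≤ (fromℕ< i<m) m≤2m) (toℕ-fromℕ< i<m))

  unfold-fold : ∀ i → uncurry unfold (fold i) ≡ i
  unfold-fold i with toℕ i ℕ.<? m
  ... | yes i<m = inject≤-fromℕ< i<m
  ... | no  i≮m = trans (cong opposite (inject≤-fromℕ< (upper⇒opposite-lower i i≮m))) (opposite-involutive i)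

  fold-lower : ∀ i → fold (inject≤ i m≤2m) ≡ (i , false)
  fold-lower i with toℕ (inject≤ i m≤2m) ℕ.<? m
  ... | yes i<m = cong (_, false) (toℕ-injective (trans (toℕ-fromℕ< i<m) (toℕ-inject≤ i m≤2m)))
  ... | no  i≮m = contradiction (subst (ℕ._< m) (sym (toℕ-inject≤ i m≤2m)) (toℕ<n i)) i≮m

  fold-opposite : ∀ i → fold (opposite i) ≡ (proj₁ (fold i) , not (proj₂ (fold i)))
  fold-opposite i with toℕ i ℕ.<? m | toℕ (opposite i) ℕ.<? m
  ... | yes i<m | yes oi<m = contradiction oi<m (lower⇒opposite-upper i i<m)
  ... | yes i<m | no  oi≮m = cong (_, true) (toℕ-injective (trans (toℕ-fromℕ< _) (trans (cong toℕ (opposite-involutive i)) (sym (toℕ-fromℕ< i<m)))))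
  ... | no  i≮m | yes oi<m = refl
  ... | no  i≮m | no  oi≮m = contradiction (upper⇒opposite-lower i i≮m) oi≮m

  fold-unfold : ∀ i s → fold (unfold i s) ≡ (i , s)
  fold-unfold i false = fold-lower i
  fold-unfold i true  = trans (fold-opposite (inject≤ i m≤2m)) (cong (λ (j , s) → j , not s) (fold-lower i))

  gridCoordinates : ∀ n → OrbitCoordinates (2 ℕ.* m) n (m ℕ.* n)
  gridCoordinates n = record
    { orbit = λ (i , j) → combine (proj₁ (fold i)) j
    ; sign  = λ (i , j) → proj₂ (fold i)
    ; point = λ ω s → unfold (proj₁ (remQuot {m} n ω)) s , proj₂ (remQuot {m} n ω)
    ; point-orbit = λ (i , j) → trans
        (cong (λ (i′ , j′) → unfold i′ (proj₂ (fold i)) , j′) (remQuot-combine (proj₁ (fold i)) j))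
        (cong (_, j) (unfold-fold i))
    ; orbit-point = λ ω s → trans
        (cong (λ (i , _) → combine i (proj₂ (remQuot {m} n ω))) (fold-unfold (proj₁ (remQuot {m} n ω)) s))
        (combine-remQuot {m} n ω)
    ; sign-point = λ ω s → cong proj₂ (fold-unfold (proj₁ (remQuot {m} n ω)) s)
    ; orbit-h = λ (i , j) → cong (λ (i′ , _) → combine i′ j) (fold-opposite i)
    ; sign-h = λ (i , j) → cong proj₂ (fold-opposite i)
    }

open import Data.Nat using (_*_; _≤_)
open import Data.Rational using () renaming (_*_ to _*q_)

-- Stated for a variable c, since comparing ι (H a b) with other rationals makes Agda unfold H.
codeCount≡⇒egf : ∀ {c} N → c ≡ codeCount (suc N) N → ι c ≡ ι (N !) *q EGF N
codeCount≡⇒egf N refl = codeCount-egf (suc N) N ℕ.≤-refl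

theorem3p1 : ∀ (m n : ℕ) → 1 ≤ m → 1 ≤ n →
    (+ H (2 * m) n / 1) ≡ (+ ((m * n) !) / 1) *q EGF (m * n)
theorem3p1 m n _ _ = codeCount≡⇒egf {H (2 * m) n} (m * n) (H≡codeCount (gridCoordinates m n))
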